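{- For a positive integer $k$, let $A_k(n)$ be defined by $$\sum_{n=0}^{\infty}A_k(n)q^n=\frac{1}{(-q;q)_\infty(-q^k;q^k)_\infty}=(q;q^2)_\infty(q^k;q^{2k})_\infty,$$ equivalently $A_k(n)=a_e^k(n)-a_o^k(n)$, where $a_e^k(n)$ (resp. $a_o^k(n)$) is the number of partitions of $n$ into an even (resp. odd) number of parts in which the parts that are multiples of $k$ may appear in two colours. Then: (i) for all $n\ge0$ and all $\alpha\ge0$, $$A_{23}\!\left(2\cdot 23^{\alpha}(23n+r)+2\cdot 23^{\alpha}+1\right)\equiv 0\pmod 2$$ for $r\in\{4,6,9,10,13,14,16,18,19,20,21\}$; (ii) if $p>3$ is a prime with Legendre symbol $\left(\frac{ -23}{p}\right)=-1$, then for all $n\ge0$, $\alpha\ge0$ and $r\in\{1,2,\dots,p-1\}$, $$A_{23}\!\left(2p^{2\alpha+1}(pn+r)+2p^{2(\alpha+1)}+1\right)\equiv 0\pmod 2.$$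
   Context: $(a;q)_\infty=\prod_{j\ge0}(1-aq^j)$ for $|q|<1$. -}

module Defs where

open import Data.Nat as ℕ using (ℕ; zero; suc; _≤_; _<_)
open import Data.Integer as ℤ using (ℤ; +_; -[1+_])
open import Data.Integer.Divisibility using (_∣_)
open import Data.List using (List; []; _∷_; zipWith; replicate; _++_; drop)
open import Data.Product using (_×_)
open import Relation.Nullary using (¬_)

-- Truncated power series: list of integer coefficients c₀, c₁, … (length N+1
-- means we keep coefficients of q^0 … q^N).
Series : Set
Series = List ℤ

-- multiply a truncated series by (1 - q^m), keeping the same truncation length
oneMinus : ℕ → Series → Series
oneMinus m cs = zipWith ℤ._-_ cs (replicate m (+ 0) ++ cs)

oneUpTo : ℕ → Series
oneUpTo N = + 1 ∷ replicate N (+ 0)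

prodOneMinus : (ℕ → ℕ) → ℕ → Series → Series
prodOneMinus f zero    s = s
prodOneMinus f (suc J) s = oneMinus (f J) (prodOneMinus f J s)

coeff : ℕ → Series → ℤ
coeff n cs with drop n cs
... | []    = + 0
... | x ∷ _ = x

-- A_k(n) = coefficient of q^n in (q;q^2)_∞ (q^k;q^{2k})_∞
--        = ∏_{j≥0} (1 - q^{2j+1}) · ∏_{j≥0} (1 - q^{k(2j+1)}).
-- Only factors with j ≤ n can affect the coefficient of q^n (for k ≥ 1),
-- so truncating both products at j < n+1 and the series at degree n is exact.
A : ℕ → ℕ → ℤ
A k n = coeff n
  (prodOneMinus (λ j → suc (2 ℕ.* j)) (suc n)
    (prodOneMinus (λ j → k ℕ.* suc (2 ℕ.* j)) (suc n) (oneUpTo n)))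

LegendreMinusOne : ℤ → ℕ → Set
LegendreMinusOne a p = ¬ ((+ p) ∣ a) × (∀ (x : ℤ) → ¬ ((+ p) ∣ (x ℤ.* x ℤ.- a)))

{-# OPTIONS --safe #-}

-- Modulo 2 the generating function of A₂₃ is 1/(f₁f₂₃), with f_c = ∏ (1 - q^(cj)).
-- Write F = q f₁f₂₃ = ∑ a(m) q^m. By the pentagonal number theorem a(m) is, modulo 2,
-- the number of (u, v) with u ≡ v ≡ 1 (mod 6) and u² + 23v² = 24m. Comparing these with
-- the representations of m by the forms x² - xy + 6y² and 2x² - xy + 3y² of
-- discriminant -23 gives the Hecke relation a(2m) ≡ a(m) + a(m/2). Since f_c² ≡ f_2c,
-- it says that the odd part of 1/(f₁f₂₃) is q(1 + F(q²)), that is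
-- A₂₃(2m+1) ≡ a(m) for m ≥ 1. In both families 24m is not of the form u² + 23v²,
-- by descent on the exponent of 23, respectively of p.
module Submission where

open import Defs
open import Data.Nat using (ℕ; zero; suc; _+_; _*_; _^_; _∸_; _%_; _≤_; _<_; z≤n; s≤s; _≤?_; NonZero; >-nonZero)
open import Data.Integer using (ℤ; +_; -[1+_]; ∣_∣; _⊖_)
open import Data.Integer.Divisibility using (_∣_)
open import Data.Nat.Primality using (Prime; prime?; euclidsLemma; prime⇒irreducible; prime⇒nonZero)
open import Data.List using (List; _∷_; []; zipWith; replicate; _++_; length; drop)
open import Data.List.Membership.Propositional using (_∈_)
open import Data.Product using (_×_; ∃; _,_; proj₂)

open import Data.Bool using (Bool; true; false; _xor_; not)
open import Data.Bool.Properties using (xor-assoc; xor-comm; xor-same; xor-identityʳ; not-involutive)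
open import Data.Fin using (Fin; toℕ; fromℕ<)
open import Data.Fin.Properties using (toℕ-fromℕ<; all?)
import Data.Integer as ℤ
import Data.Integer.Properties as ℤ
import Data.Integer.Solver
import Data.Integer.Tactic.RingSolver as ℤR
open import Data.List.Properties using (length-replicate; length-++; length-zipWith)
open import Data.List.Relation.Unary.All as All using (All)
open import Data.Nat.Coprimality using (Coprime; coprime-Bézout)
import Data.Nat.Divisibility as ℕ
open import Data.Nat.DivMod using (m%n<n; [m+kn]%n≡m%n; %-distribˡ-*)
open import Data.Nat.GCD using (module Bézout)
open import Data.Nat.Properties
open import Data.Nat.Tactic.RingSolver using (solve-∀)
open import Data.Sum using (_⊎_; inj₁; inj₂; [_,_]′)
open import Algebra.Properties.CommutativeSemigroup +-commutativeSemigroup using (interchange)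
open import Function using (_∘_; id)
open import Relation.Nullary using (Dec; yes; no; ¬_; ¬?; contradiction)
open import Relation.Nullary.Decidable using (from-yes)
open import Relation.Binary.PropositionalEquality using (_≡_; _≢_; refl; sym; trans; cong; cong₂; subst; _≗_; module ≡-Reasoning)
open Data.Integer.Solver.+-*-Solver using (Polynomial; con; _:+_; _:*_; _:-_; :-_; solve; _:=_)

-- Power series over 𝔽₂

-- The class group of discriminant -23 has order 3 and 2 splits into two nonprincipal primes. Hence
-- the Hecke operator at 2 sends the theta series of f = x² - xy + 6y² to twice that of h = 2x² - xy
-- + 3y², and that of h to the sum of both. The obstacle is that the pairs (u, v) make up only half
-- of certain representations by f and h together, so their parity depends on those counts modulo 4.
-- Reduction modulo 2 therefore comes late: counts are natural numbers, related by exact changes of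
-- variables on ℤ², and a factor 2 is cancelled from the sum of all relations before parities are
-- taken. The correction `excess`, half of the representations whose first variable shares a factor
-- with 6, is even by the symmetry (v, y) ↦ (-v, -y). A third form g = 2v² - 5vy + 6y², equivalent
-- to h, appears because the pairs with u ≡ v + 6 (mod 12) land on it.

xor-interchange : ∀ a b c d → (a xor b) xor (c xor d) ≡ (a xor c) xor (b xor d)
xor-interchange false b false d = refl
xor-interchange false false true d = refl
xor-interchange false true true false = refl
xor-interchange false true true true = refl
xor-interchange true false false d = refl
xor-interchange true true false false = refl
xor-interchange true true false true = refl
xor-interchange true false true false = refl
xor-interchange true false true true = refl
xor-interchange true true true false = refl
xor-interchange true true true true = refl

xor-cancelʳ : ∀ a b c → a xor c ≡ b xor c → a ≡ b
xor-cancelʳ false false _ _ = refl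
xor-cancelʳ true  true  _ _ = refl
xor-cancelʳ false true  false ()
xor-cancelʳ false true  true ()
xor-cancelʳ true  false false ()
xor-cancelʳ true  false true ()

xor-merge : ∀ a b c → (a xor b) xor (b xor c) ≡ a xor c
xor-merge a false c = cong (_xor c) (xor-identityʳ a)
xor-merge false true false = refl
xor-merge false true true = refl
xor-merge true true c = refl

Series₂ : Set
Series₂ = ℕ → Bool

infix 4 _≈[_]_
_≈[_]_ : Series₂ → ℕ → Series₂ → Set
f ≈[ N ] g = ∀ n → n ≤ N → f n ≡ g n

infixl 6 _⊕_
_⊕_ : Series₂ → Series₂ → Series₂
(f ⊕ g) n = f n xor g n

one : Series₂
one zero    = true
one (suc _) = false

sh : ℕ → Series₂ → Series₂
sh zero    f n       = f n
sh (suc m) f zero    = false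
sh (suc m) f (suc n) = sh m f n

-- Multiplication by 1 - q^m, with `sh m` as multiplication by q^m; the sign is lost modulo 2.
E : ℕ → Series₂ → Series₂
E m f = f ⊕ sh m f

sh-cong : ∀ m {f g N} → f ≈[ N ] g → sh m f ≈[ N ] sh m g
sh-cong zero    eq n       n≤N = eq n n≤N
sh-cong (suc m) eq zero    _   = refl
sh-cong (suc m) eq (suc n) n<N = sh-cong m eq n (<⇒≤ n<N)

sh-congˢ : ∀ m {f g} → f ≗ g → sh m f ≗ sh m g
sh-congˢ m eq n = sh-cong m (λ i _ → eq i) n ≤-refl

sh-sh : ∀ a b f → sh a (sh b f) ≗ sh (a + b) f
sh-sh zero    b f n       = refl
sh-sh (suc a) b f zero    = refl
sh-sh (suc a) b f (suc n) = sh-sh a b f n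

sh-⊕ : ∀ m f g → sh m (f ⊕ g) ≗ sh m f ⊕ sh m g
sh-⊕ zero    f g n       = refl
sh-⊕ (suc m) f g zero    = refl
sh-⊕ (suc m) f g (suc n) = sh-⊕ m f g n

sh-small : ∀ {m n} f → n < m → sh m f n ≡ false
sh-small {suc m} {zero}  f _         = refl
sh-small {suc m} {suc n} f (s≤s n<m) = sh-small f n<m

sh-comm : ∀ a b f → sh a (sh b f) ≗ sh b (sh a f)
sh-comm a b f n =
  trans (sh-sh a b f n) (trans (cong (λ c → sh c f n) (+-comm a b)) (sym (sh-sh b a f n)))

E-sh : ∀ m a f → E m (sh a f) ≗ sh a (E m f)
E-sh m a f n = trans (cong (sh a f n xor_) (sh-comm m a f n)) (sym (sh-⊕ a f (sh m f) n))

E-cong : ∀ m {f g N} → f ≈[ N ] g → E m f ≈[ N ] E m g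
E-cong m eq n n≤N = cong₂ _xor_ (eq n n≤N) (sh-cong m eq n n≤N)

E-congˢ : ∀ m {f g} → f ≗ g → E m f ≗ E m g
E-congˢ m eq n = E-cong m (λ i _ → eq i) n ≤-refl

E-⊕ : ∀ m f g → E m (f ⊕ g) ≗ E m f ⊕ E m g
E-⊕ m f g n =
  trans (cong ((f n xor g n) xor_) (sh-⊕ m f g n))
        (xor-interchange (f n) (g n) (sh m f n) (sh m g n))

E-comm : ∀ a b f → E a (E b f) ≗ E b (E a f)
E-comm a b f n = begin
  E b f n xor sh a (E b f) n  ≡⟨ cong (E b f n xor_) (sym (E-sh b a f n)) ⟩
  E b f n xor E b (sh a f) n  ≡⟨ sym (E-⊕ b f (sh a f) n) ⟩
  E b (E a f) n               ∎
  where open ≡-Reasoning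

-- Frobenius: the two cross terms q^m cancel in characteristic 2.
E-square : ∀ m f → E m (E m f) ≗ E (m + m) f
E-square m f n = begin
  (f n xor sh m f n) xor sh m (f ⊕ sh m f) n
    ≡⟨ cong (E m f n xor_) (sh-⊕ m f (sh m f) n) ⟩
  (f n xor sh m f n) xor (sh m f n xor sh m (sh m f) n)
    ≡⟨ xor-merge (f n) (sh m f n) _ ⟩
  f n xor sh m (sh m f) n
    ≡⟨ cong (f n xor_) (sh-sh m m f n) ⟩
  f n xor sh (m + m) f n ∎
  where open ≡-Reasoning

-- The factor has constant term 1 and positive exponent, so each coefficient is recovered from the
-- lower ones. This is what allows division by the products.
E-injective : ∀ m {f g} N → E (suc m) f ≈[ N ] E (suc m) g → f ≈[ N ] g
E-injective m zero eq .zero z≤n = xor-cancelʳ _ _ false (eq 0 z≤n)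
E-injective m {f} {g} (suc N) eq n n≤1+N with m≤n⇒m<n∨m≡n n≤1+N
... | inj₁ (s≤s n≤N) = E-injective m {f} {g} N (λ i i≤N → eq i (m≤n⇒m≤1+n i≤N)) n n≤N
... | inj₂ refl = xor-cancelʳ _ _ (sh m f N)
        (trans (eq (suc N) ≤-refl) (cong (g (suc N) xor_) (sym (sh-cong m rec N ≤-refl))))
  where rec = E-injective m {f} {g} N (λ i i≤N → eq i (m≤n⇒m≤1+n i≤N))

prodE : (ℕ → ℕ) → ℕ → Series₂ → Series₂
prodE e zero    f = f
prodE e (suc J) f = E (e J) (prodE e J f)

module _ (e : ℕ → ℕ) where

  prodE-cong : ∀ J {f g N} → f ≈[ N ] g → prodE e J f ≈[ N ] prodE e J g
  prodE-cong zero    eq = eq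
  prodE-cong (suc J) eq = E-cong (e J) (prodE-cong J eq)

  prodE-congˢ : ∀ J {f g} → f ≗ g → prodE e J f ≗ prodE e J g
  prodE-congˢ J eq n = prodE-cong J (λ i _ → eq i) n ≤-refl

  prodE-E : ∀ J m f → prodE e J (E m f) ≗ E m (prodE e J f)
  prodE-E zero    m f n = refl
  prodE-E (suc J) m f n =
    trans (E-congˢ (e J) (prodE-E J m f) n) (E-comm (e J) m (prodE e J f) n)

  prodE-sh : ∀ J m f → prodE e J (sh m f) ≗ sh m (prodE e J f)
  prodE-sh zero    m f n = refl
  prodE-sh (suc J) m f n =
    trans (E-congˢ (e J) (prodE-sh J m f) n) (E-sh (e J) m (prodE e J f) n)

  prodE-⊕ : ∀ J f g → prodE e J (f ⊕ g) ≗ prodE e J f ⊕ prodE e J g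
  prodE-⊕ zero    f g n = refl
  prodE-⊕ (suc J) f g n =
    trans (E-congˢ (e J) (prodE-⊕ J f g) n) (E-⊕ (e J) (prodE e J f) (prodE e J g) n)

  prodE-injective : (∀ j → 1 ≤ e j) → ∀ J {f g} N → prodE e J f ≈[ N ] prodE e J g → f ≈[ N ] g
  prodE-injective pos zero    N eq = eq
  prodE-injective pos (suc J) N eq with e J | pos J
  ... | suc m | _ = prodE-injective pos J N (E-injective m N eq)

  prodE-square : ∀ J f → prodE (λ j → e j + e j) J f ≗ prodE e J (prodE e J f)
  prodE-square zero    f n = refl
  prodE-square (suc J) f n = begin
    E (e J + e J) (prodE (λ j → e j + e j) J f) n
      ≡⟨ E-congˢ (e J + e J) (prodE-square J f) n ⟩
    E (e J + e J) (prodE e J (prodE e J f)) n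
      ≡⟨ sym (E-square (e J) (prodE e J (prodE e J f)) n) ⟩
    E (e J) (E (e J) (prodE e J (prodE e J f))) n
      ≡⟨ E-congˢ (e J) (λ i → sym (prodE-E J (e J) (prodE e J f) i)) n ⟩
    E (e J) (prodE e J (E (e J) (prodE e J f))) n ∎
    where open ≡-Reasoning

prodE-prodE : ∀ e e′ J J′ f → prodE e J (prodE e′ J′ f) ≗ prodE e′ J′ (prodE e J f)
prodE-prodE e e′ J zero     f n = refl
prodE-prodE e e′ J (suc J′) f n =
  trans (prodE-E e J (e′ J′) (prodE e′ J′ f) n) (E-congˢ (e′ J′) (prodE-prodE e e′ J J′ f) n)

prodE-ext : ∀ {e e′} → e ≗ e′ → ∀ J f → prodE e J f ≗ prodE e′ J f
prodE-ext eq zero    f n = refl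
prodE-ext {e} {e′} eq (suc J) f n =
  trans (cong (λ m → E m (prodE e J f) n) (eq J)) (E-congˢ (e′ J) (prodE-ext eq J f) n)

prodE-interleave : ∀ e N f →
  prodE (λ j → e (suc (2 * j))) N (prodE (λ j → e (2 * j)) N f) ≗ prodE e (2 * N) f
prodE-interleave e zero    f n = refl
prodE-interleave e (suc N) f n = begin
  E b (prodE eo N (E a (prodE ee N f))) n  ≡⟨ E-congˢ b (prodE-E eo N a (prodE ee N f)) n ⟩
  E b (E a (prodE eo N (prodE ee N f))) n  ≡⟨ E-congˢ b (E-congˢ a (prodE-interleave e N f)) n ⟩
  prodE e (2 + 2 * N) f n                  ≡⟨ cong (λ M → prodE e M f n) (sym (*-suc 2 N)) ⟩
  prodE e (2 * suc N) f n                  ∎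
  where
  open ≡-Reasoning
  eo ee : ℕ → ℕ
  eo j = e (suc (2 * j))
  ee j = e (2 * j)
  a = ee N
  b = eo N

sum₂ : ℕ → (ℕ → Bool) → Bool
sum₂ zero    h = false
sum₂ (suc K) h = sum₂ K h xor h K

sum₂-cong : ∀ K {h h′} → (∀ i → i < K → h i ≡ h′ i) → sum₂ K h ≡ sum₂ K h′
sum₂-cong zero    eq = refl
sum₂-cong (suc K) eq = cong₂ _xor_ (sum₂-cong K (λ i i<K → eq i (m≤n⇒m≤1+n i<K))) (eq K ≤-refl)

sum₂-xor : ∀ K h h′ → sum₂ K (λ i → h i xor h′ i) ≡ sum₂ K h xor sum₂ K h′
sum₂-xor zero    h h′ = refl
sum₂-xor (suc K) h h′ =
  trans (cong (_xor (h K xor h′ K)) (sum₂-xor K h h′)) (xor-interchange (sum₂ K h) (sum₂ K h′) (h K) (h′ K))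

sum₂-false : ∀ K {h} → (∀ i → i < K → h i ≡ false) → sum₂ K h ≡ false
sum₂-false zero    eq = refl
sum₂-false (suc K) eq = cong₂ _xor_ (sum₂-false K (λ i i<K → eq i (m≤n⇒m≤1+n i<K))) (eq K ≤-refl)

-- The index range of a sum over ℤ with cutoff K is -K ≤ k < K.
sumℤ₂ : ℕ → (ℤ → Bool) → Bool
sumℤ₂ K F = sum₂ K (λ i → F (+ i) xor F (-[1+ i ]))

sumℤ₂-cong : ∀ K {F G : ℤ → Bool} → (∀ k → F k ≡ G k) → sumℤ₂ K F ≡ sumℤ₂ K G
sumℤ₂-cong K eq = sum₂-cong K (λ i _ → cong₂ _xor_ (eq (+ i)) (eq (-[1+ i ])))

sh-sum₂ : ∀ e K (F : ℕ → Series₂) n →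
  sh e (λ d → sum₂ K (λ i → F i d)) n ≡ sum₂ K (λ i → sh e (F i) n)
sh-sum₂ zero    K F n       = refl
sh-sum₂ (suc e) K F zero    = sym (sum₂-false K (λ _ _ → refl))
sh-sum₂ (suc e) K F (suc n) = sh-sum₂ e K F n

sh-sumℤ₂ : ∀ e K (F : ℤ → Series₂) n → sh e (λ d → sumℤ₂ K (λ k → F k d)) n ≡ sumℤ₂ K (λ k → sh e (F k) n)
sh-sumℤ₂ e K F n = trans (sh-sum₂ e K (λ i → F (+ i) ⊕ F (-[1+ i ])) n)
  (sum₂-cong K (λ i _ → sh-⊕ e (F (+ i)) (F (-[1+ i ])) n))

-- The pentagonal number theorem modulo 2

tri : ℕ → ℕ
tri zero    = 0
tri (suc n) = suc n + tri n

-- The generalised pentagonal number k(3k+1)/2.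
ω : ℤ → ℕ
ω (+ n)      = n * n + tri n
ω (-[1+ n ]) = suc n * suc n + tri n

-- Shanks' finite form of the pentagonal number theorem, modulo 2 and with q
-- replaced by q^c:
--   ∑_{s≤n} (q;q)_n/(q;q)_s q^(sn+s(s+1)/2) ≡ ∑_{k=-n}^{n} q^(k(3k+1)/2).
-- Only the summand s = 0 contributes below degree n + 1.
module Shanks (c : ℕ) where

  τ : ℕ → Series₂ → Series₂
  τ e = sh (c * e)

  τ-τ : ∀ a b f → τ a (τ b f) ≗ τ (a + b) f
  τ-τ a b f n = trans (sh-sh (c * a) (c * b) f n) (cong (λ e → sh e f n) (sym (*-distribˡ-+ c a b)))

  τ-zero : ∀ f → τ 0 f ≗ f
  τ-zero f n = cong (λ e → sh e f n) (*-zeroʳ c)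

  -- factors from s + 1 to s + d
  range : ℕ → ℕ → Series₂ → Series₂
  range s zero    f = f
  range s (suc d) f = E (c * suc s) (range (suc s) d f)

  range-last : ∀ s d f → range s (suc d) f ≗ E (c * suc (s + d)) (range s d f)
  range-last s zero    f n = cong (λ m → E (c * suc m) f n) (sym (+-identityʳ s))
  range-last s (suc d) f n = begin
    E (c * suc s) (range (suc s) (suc d) f) n
      ≡⟨ E-congˢ (c * suc s) (range-last (suc s) d f) n ⟩
    E (c * suc s) (E (c * suc (suc s + d)) (range (suc s) d f)) n
      ≡⟨ E-comm (c * suc s) (c * suc (suc s + d)) (range (suc s) d f) n ⟩
    E (c * suc (suc s + d)) (range s (suc d) f) n
      ≡⟨ cong (λ m → E (c * suc m) (range s (suc d) f) n) (sym (+-suc s d)) ⟩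
    E (c * suc (s + suc d)) (range s (suc d) f) n ∎
    where open ≡-Reasoning

  range-prodE : ∀ n f → range 0 n f ≗ prodE (λ j → c * suc j) n f
  range-prodE zero    f i = refl
  range-prodE (suc n) f i = trans (range-last 0 n f i) (E-congˢ (c * suc n) (range-prodE n f) i)

  module _ (f : Series₂) where

    D : ℕ → ℕ → Series₂
    D n s = range s (n ∸ s) f

    term : ℕ → ℕ → Series₂
    term n s = τ (s * n + tri s) (D n s)

    R : ℕ → Series₂
    R n d = sum₂ (suc n) (λ s → term n s d)

    D-last : ∀ n s → s ≤ n → D (suc n) s ≗ E (c * suc n) (D n s)
    D-last n s s≤n d = begin
      range s (suc n ∸ s) f d             ≡⟨ cong (λ m → range s m f d) (+-∸-assoc 1 s≤n) ⟩
      range s (suc (n ∸ s)) f d           ≡⟨ range-last s (n ∸ s) f d ⟩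
      E (c * suc (s + (n ∸ s))) (D n s) d ≡⟨ cong (λ m → E (c * suc m) (D n s) d) (m+[n∸m]≡n s≤n) ⟩
      E (c * suc n) (D n s) d             ∎
      where open ≡-Reasoning

    D-first : ∀ n t → t < n → D n t ≗ E (c * suc t) (D n (suc t))
    D-first n t t<n d = cong (λ m → range t m f d) (trans (cong (_∸ t) (sym (m+[n∸m]≡n t<n)))
      (trans (cong (_∸ t) (sym (+-suc t (n ∸ suc t)))) (m+n∸m≡n t (suc (n ∸ suc t)))))

    τ-E : ∀ a m g → τ a (E (c * m) g) ≗ τ a g ⊕ τ (a + m) g
    τ-E a m g d = trans (sh-⊕ (c * a) g (τ m g) d) (cong (τ a g d xor_) (τ-τ a m g d))

    -- `D-first` opens the factor t + 1 in the closed form at t, and `D-last` the factor n + 1 in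
    -- the new summand. All five resulting terms are monomial multiples of the same product `X`, and
    -- four of them cancel in pairs.
    telescope : ∀ n t → t ≤ n → ∀ d →
      sum₂ (suc t) (λ s → term (suc n) s d xor term n s d) ≡ τ (suc t * suc n + tri t) (D n t) d
    telescope n zero t≤n d = begin
      τ 0 (D (suc n) 0) d xor τ 0 (D n 0) d
        ≡⟨ cong₂ _xor_ (trans (τ-zero (D (suc n) 0) d) (D-last n 0 z≤n d)) (τ-zero (D n 0) d) ⟩
      (D n 0 d xor τ (suc n) (D n 0) d) xor D n 0 d
        ≡⟨ xor-outer (D n 0 d) (τ (suc n) (D n 0) d) ⟩
      τ (suc n) (D n 0) d
        ≡⟨ cong (λ e → τ e (D n 0) d) (solve-n n) ⟩
      τ (1 * suc n + tri 0) (D n 0) d ∎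
      where
      open ≡-Reasoning
      xor-outer : ∀ a b → (a xor b) xor a ≡ b
      xor-outer false b = xor-identityʳ b
      xor-outer true false = refl
      xor-outer true true = refl
      solve-n : ∀ n → suc n ≡ 1 * suc n + 0
      solve-n = solve-∀
    telescope n (suc t) t<n d = begin
      sum₂ (suc t) (λ s → term (suc n) s d xor term n s d) xor (term (suc n) (suc t) d xor term n (suc t) d)
        ≡⟨ cong₂ _xor_ (trans (telescope n t (<⇒≤ t<n) d) prev) (cong (_xor term n (suc t) d) cur) ⟩
      (τ a X d xor τ b X d) xor ((τ b X d xor τ b′ X d) xor τ a′ X d)
        ≡⟨ cong (λ z → (τ a X d xor τ b X d) xor ((τ b X d xor τ b′ X d) xor z)) (cong (λ e → τ e X d) (sym (a≡a′ t n (tri t)))) ⟩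
      (τ a X d xor τ b X d) xor ((τ b X d xor τ b′ X d) xor τ a X d)
        ≡⟨ xor-square (τ a X d) (τ b X d) (τ b′ X d) ⟩
      τ b′ X d
        ≡⟨ cong (λ e → τ e X d) (b′≡ t n (tri t)) ⟩
      τ (suc (suc t) * suc n + tri (suc t)) X d ∎
      where
      open ≡-Reasoning
      X = D n (suc t)
      a  = suc t * suc n + tri t
      a′ = suc t * n + tri (suc t)
      b  = suc t * suc n + tri (suc t)
      b′ = b + suc n
      a≡a′ : ∀ t n x → suc t * suc n + x ≡ suc t * n + (suc t + x)
      a≡a′ = solve-∀
      b≡ : ∀ t n x → suc t * suc n + x + suc t ≡ suc t * suc n + (suc t + x)
      b≡ = solve-∀
      b′≡ : ∀ t n x → suc t * suc n + (suc t + x) + suc n ≡ suc (suc t) * suc n + (suc t + x)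
      b′≡ = solve-∀
      xor-square : ∀ x y z → (x xor y) xor ((y xor z) xor x) ≡ z
      xor-square false false z = xor-identityʳ z
      xor-square false true false = refl
      xor-square false true true = refl
      xor-square true false false = refl
      xor-square true false true = refl
      xor-square true true false = refl
      xor-square true true true = refl
      prev : τ a (D n t) d ≡ τ a X d xor τ b X d
      prev = trans (sh-congˢ (c * a) (D-first n t t<n) d)
        (trans (τ-E a (suc t) X d) (cong (λ e → τ a X d xor τ e X d) (b≡ t n (tri t))))
      cur : term (suc n) (suc t) d ≡ τ b X d xor τ b′ X d
      cur = trans (sh-congˢ (c * b) (D-last n (suc t) t<n) d) (τ-E b (suc n) X d)

    D-diag : ∀ n → D n n ≗ f
    D-diag n d = cong (λ m → range n m f d) (n∸n≡0 n)

    -- At t = n the telescoped exponent is (n + 1)² + n(n + 1)/2, the pentagonal number of -(n + 1).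
    -- The summand s = n + 1, present only in `R (suc n)`, supplies the pentagonal number of n + 1.
    R-suc : ∀ n d → R (suc n) d ≡ (R n d xor τ (ω (-[1+ n ])) f d) xor τ (ω (+ suc n)) f d
    R-suc n d = cong₂ _xor_ lower (sh-congˢ (c * ω (+ suc n)) (D-diag (suc n)) d)
      where
      h h′ : ℕ → Bool
      h  s = term (suc n) s d
      h′ s = term n s d
      move : ∀ x y z → x xor y ≡ z → x ≡ y xor z
      move false y z refl = sym (xor-same y)
      move true false z refl = refl
      move true true z refl = refl
      lower : sum₂ (suc n) h ≡ R n d xor τ (ω (-[1+ n ])) f d
      lower = move _ _ _ (trans (sym (sum₂-xor (suc n) h h′))
        (trans (telescope n n ≤-refl d) (sh-congˢ (c * ω (-[1+ n ])) (D-diag n) d)))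

    shanks : ∀ n d → R n d ≡ sumℤ₂ n (λ k → τ (ω k) f d) xor τ (ω (+ n)) f d
    shanks zero    d = refl
    shanks (suc n) d = trans (R-suc n d) (cong (_xor τ (ω (+ suc n)) f d)
      (trans (cong (_xor τ (ω (-[1+ n ])) f d) (shanks n d)) (xor-assoc (sumℤ₂ n (λ k → τ (ω k) f d)) _ _)))

    R-low : 1 ≤ c → ∀ n d → d ≤ n → R n d ≡ prodE (λ j → c * suc j) n f d
    R-low 1≤c n d d≤n = trans (low n ≤-refl) (range-prodE n f d)
      where
      big : ∀ s → d < c * (suc s * n + tri (suc s))
      big s = ≤-trans (s≤s d≤n) (≤-trans le (m≤n*m _ c {{>-nonZero 1≤c}}))
        where
        le : suc n ≤ suc s * n + tri (suc s)
        le = subst (_≤ suc s * n + tri (suc s)) (+-comm n 1)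
          (+-mono-≤ (m≤n*m n (suc s)) (s≤s z≤n))
      low : ∀ t → t ≤ n → sum₂ (suc t) (λ s → term n s d) ≡ range 0 n f d
      low zero    _   = τ-zero (D n 0) d
      low (suc t) t<n = trans (cong₂ _xor_ (low t (<⇒≤ t<n)) (sh-small (D n (suc t)) (big t)))
        (xor-identityʳ _)

  pentagonal : 1 ≤ c → ∀ N f d → d ≤ N →
    prodE (λ j → c * suc j) N f d ≡ sumℤ₂ (suc N) (λ k → τ (ω k) f d)
  pentagonal 1≤c N f d d≤N = begin
    prodE (λ j → c * suc j) N f d                              ≡⟨ sym (R-low f 1≤c N d d≤N) ⟩
    R f N d                                                    ≡⟨ shanks f N d ⟩
    sumℤ₂ N F xor F (+ N)                                         ≡⟨ cong (sumℤ₂ N F xor_) (sym (xor-identityʳ (F (+ N)))) ⟩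
    -- The finite identity runs over -N ≤ k ≤ N, the half-open range of `sumℤ₂ (suc N)` also over k
    -- = -N - 1, whose exponent exceeds N.
    sumℤ₂ N F xor (F (+ N) xor false)                             ≡⟨ cong (λ z → sumℤ₂ N F xor (F (+ N) xor z)) (sym (sh-small f big)) ⟩
    sumℤ₂ N F xor (F (+ N) xor F (-[1+ N ]))                      ∎
    where
    open ≡-Reasoning
    F : ℤ → Bool
    F k = τ (ω k) f d
    big : d < c * ω (-[1+ N ])
    big = ≤-trans (s≤s d≤N) (≤-trans (≤-trans (m≤m*n (suc N) (suc N)) (m≤m+n _ (tri N)))
      (m≤n*m _ c {{>-nonZero 1≤c}}))

pentagonal₂ : ∀ N d → d ≤ N →
  prodE (λ j → 1 * suc j) N (prodE (λ j → 23 * suc j) N one) d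
    ≡ sumℤ₂ (suc N) (λ k → sumℤ₂ (suc N) (λ j → sh (ω k + 23 * ω j) one d))
pentagonal₂ N d d≤N = trans (Shanks.pentagonal 1 ≤-refl N _ d d≤N) (sumℤ₂-cong (suc N) inner)
  where
  open ≡-Reasoning
  P₂₃ = prodE (λ j → 23 * suc j) N one
  inner : ∀ k → sh (1 * ω k) P₂₃ d ≡ sumℤ₂ (suc N) (λ j → sh (ω k + 23 * ω j) one d)
  inner k = begin
    sh (1 * ω k) P₂₃ d
      ≡⟨ sh-cong (1 * ω k) (Shanks.pentagonal 23 (s≤s z≤n) N one) d d≤N ⟩
    sh (1 * ω k) (λ i → sumℤ₂ (suc N) (λ j → sh (23 * ω j) one i)) d
      ≡⟨ sh-sumℤ₂ (1 * ω k) (suc N) (λ j → sh (23 * ω j) one) d ⟩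
    sumℤ₂ (suc N) (λ j → sh (1 * ω k) (sh (23 * ω j) one) d)
      ≡⟨ sumℤ₂-cong (suc N) (λ j → trans (sh-sh (1 * ω k) (23 * ω j) one d)
           (cong (λ e → sh (e + 23 * ω j) one d) (*-identityˡ (ω k)))) ⟩
    sumℤ₂ (suc N) (λ j → sh (ω k + 23 * ω j) one d) ∎

-- Finitely supported sums over ℤ and ℤ²

sumN : ℕ → (ℕ → ℕ) → ℕ
sumN zero    h = 0
sumN (suc K) h = sumN K h + h K

sumN-cong : ∀ K {h h′} → h ≗ h′ → sumN K h ≡ sumN K h′
sumN-cong zero    eq = refl
sumN-cong (suc K) eq = cong₂ _+_ (sumN-cong K eq) (eq K)

sumN-+ : ∀ K h h′ → sumN K (λ i → h i + h′ i) ≡ sumN K h + sumN K h′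
sumN-+ zero    h h′ = refl
sumN-+ (suc K) h h′ = trans (cong (_+ (h K + h′ K)) (sumN-+ K h h′)) (interchange (sumN K h) (sumN K h′) (h K) (h′ K))

sumN-zero : ∀ K → sumN K (λ _ → 0) ≡ 0
sumN-zero zero    = refl
sumN-zero (suc K) = trans (+-identityʳ _) (sumN-zero K)

sumN-swap : ∀ K L (w : ℕ → ℕ → ℕ) → sumN K (λ i → sumN L (w i)) ≡ sumN L (λ j → sumN K (λ i → w i j))
sumN-swap zero    L w = sym (sumN-zero L)
sumN-swap (suc K) L w = trans (cong (_+ sumN L (w K)) (sumN-swap K L w)) (sym (sumN-+ L _ (w K)))

sumN-head : ∀ K h → sumN (suc K) h ≡ h 0 + sumN K (λ i → h (suc i))
sumN-head zero    h = +-comm 0 (h 0)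
sumN-head (suc K) h = trans (cong (_+ h (suc K)) (sumN-head K h)) (+-assoc (h 0) _ _)

term≤sumN : ∀ K h i → i < K → h i ≤ sumN K h
term≤sumN (suc K) h i (s≤s i≤K) with m≤n⇒m<n∨m≡n i≤K
... | inj₁ i<K  = ≤-trans (term≤sumN K h i i<K) (m≤m+n _ _)
... | inj₂ refl = m≤n+m _ _

sumℤ : ℕ → (ℤ → ℕ) → ℕ
sumℤ K F = sumN K (λ i → F (+ i) + F (-[1+ i ]))

sumℤ-cong : ∀ K {F G} → F ≗ G → sumℤ K F ≡ sumℤ K G
sumℤ-cong K eq = sumN-cong K (λ i → cong₂ _+_ (eq (+ i)) (eq (-[1+ i ])))

sumℤ-+ : ∀ K F G → sumℤ K (λ v → F v + G v) ≡ sumℤ K F + sumℤ K G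
sumℤ-+ K F G = trans (sumN-cong K (λ i → interchange (F (+ i)) (G (+ i)) (F (-[1+ i ])) (G (-[1+ i ]))))
  (sumN-+ K _ _)

sumℤ-halves : ∀ K F → sumℤ K F ≡ sumN K (λ i → F (+ i)) + sumN K (λ i → F (-[1+ i ]))
sumℤ-halves K F = sumN-+ K _ _

sumℤ-swap : ∀ K L (w : ℤ → ℤ → ℕ) → sumℤ K (λ v → sumℤ L (w v)) ≡ sumℤ L (λ y → sumℤ K (λ v → w v y))
sumℤ-swap K L w = trans (sumN-cong K (λ i → sym (sumℤ-+ L (w (+ i)) (w (-[1+ i ])))))
  (trans (sumN-swap K L _) (sumN-cong L (λ _ → sumN-+ K _ _)))

Supp : ℕ → (ℤ → ℕ) → Set
Supp K F = ∀ v → K ≤ ∣ v ∣ → F v ≡ 0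

sumℤ-zero : ∀ K {F} → (∀ v → F v ≡ 0) → sumℤ K F ≡ 0
sumℤ-zero K eq = trans (sumℤ-cong K eq) (sumN-zero K)

sumℤ-extend : ∀ K d {F} → Supp K F → sumℤ (d + K) F ≡ sumℤ K F
sumℤ-extend K zero    supp = refl
sumℤ-extend K (suc d) {F} supp = trans (cong₂ _+_ (sumℤ-extend K d supp)
  (cong₂ _+_ (supp (+ (d + K)) (m≤n+m K d)) (supp (-[1+ d + K ]) (m≤n⇒m≤1+n (m≤n+m K d))))) (+-identityʳ _)

sumℤ-extend-≤ : ∀ {K L F} → K ≤ L → Supp K F → sumℤ L F ≡ sumℤ K F
sumℤ-extend-≤ {K} {L} {F} K≤L supp = trans (cong (λ M → sumℤ M F) (sym (m∸n+n≡m K≤L))) (sumℤ-extend K (L ∸ K) supp)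

sumℤ-unique : ∀ {K L F} → Supp K F → Supp L F → sumℤ K F ≡ sumℤ L F
sumℤ-unique {K} {L} {F} sK sL = trans (sym (sumℤ-extend-≤ (m≤m+n K L) sK)) (sumℤ-extend-≤ (m≤n+m L K) sL)

sumℤ-suc : ∀ {K F} → Supp K F → sumℤ (suc K) (λ v → F (v ℤ.+ + 1)) ≡ sumℤ K F
sumℤ-suc {K} {F} supp = begin
  sumℤ (suc K) (λ v → F (v ℤ.+ + 1))
    ≡⟨ sumℤ-halves (suc K) (λ v → F (v ℤ.+ + 1)) ⟩
  sumN (suc K) (λ i → F (+ (i + 1))) + sumN (suc K) (λ i → F (-[1+ i ] ℤ.+ + 1))
    ≡⟨ cong₂ _+_ (sumN-cong (suc K) (λ i → cong (λ n → F (+ n)) (+-comm i 1))) (sumN-head K _) ⟩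
  P + (F (+ 0) + N)
    ≡⟨ rearrange P (F (+ 0)) N ⟩
  (F (+ 0) + P) + N
    ≡⟨ cong (_+ N) (sym (sumN-head (suc K) (λ i → F (+ i)))) ⟩
  sumN K (λ i → F (+ i)) + F (+ K) + F (+ suc K) + N
    ≡⟨ cong₂ (λ a b → sumN K (λ i → F (+ i)) + a + b + N) (supp (+ K) ≤-refl) (supp (+ suc K) (n≤1+n K)) ⟩
  sumN K (λ i → F (+ i)) + 0 + 0 + N
    ≡⟨ cong (_+ N) (trans (+-identityʳ _) (+-identityʳ _)) ⟩
  sumN K (λ i → F (+ i)) + N
    ≡⟨ sym (sumℤ-halves K F) ⟩
  sumℤ K F ∎
  where
  open ≡-Reasoning
  P = sumN (suc K) (λ i → F (+ suc i))
  N = sumN K (λ i → F (-[1+ i ]))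
  rearrange : ∀ a b c → a + (b + c) ≡ (b + a) + c
  rearrange = solve-∀

∣v∣≤∣v+a∣+∣a∣ : ∀ v a → ∣ v ∣ ≤ ∣ v ℤ.+ a ∣ + ∣ a ∣
∣v∣≤∣v+a∣+∣a∣ v a = subst (λ z → ∣ z ∣ ≤ ∣ v ℤ.+ a ∣ + ∣ a ∣) (cancel v a) (ℤ.∣i-j∣≤∣i∣+∣j∣ (v ℤ.+ a) a)
  where
  cancel : ∀ v a → v ℤ.+ a ℤ.- a ≡ v
  cancel = ℤR.solve-∀

Supp-shift : ∀ {K F} a → Supp K F → Supp (K + ∣ a ∣) (λ v → F (v ℤ.+ a))
Supp-shift {K} a supp v le = supp (v ℤ.+ a) (+-cancelʳ-≤ ∣ a ∣ K _ (≤-trans le (∣v∣≤∣v+a∣+∣a∣ v a)))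

sumℤ-shift⁺ : ∀ n {K L F} → Supp K F → Supp L (λ v → F (v ℤ.+ + n)) → sumℤ L (λ v → F (v ℤ.+ + n)) ≡ sumℤ K F
sumℤ-shift⁺ zero {K} {L} {F} sK sL = trans (sumℤ-cong L eq) (sumℤ-unique (λ v le → trans (sym (eq v)) (sL v le)) sK)
  where
  eq : ∀ v → F (v ℤ.+ + 0) ≡ F v
  eq v = cong F (ℤ.+-identityʳ v)
sumℤ-shift⁺ (suc n) {K} {L} {F} sK sL = begin
  sumℤ L (λ v → F (v ℤ.+ + suc n))
    ≡⟨ sumℤ-unique sL (λ v le → trans (eq v) (sup1 v le)) ⟩
  sumℤ (suc (K + n)) (λ v → F (v ℤ.+ + suc n))
    ≡⟨ sumℤ-cong (suc (K + n)) eq ⟩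
  sumℤ (suc (K + n)) (λ v → G (v ℤ.+ + 1))
    ≡⟨ sumℤ-suc supG ⟩
  sumℤ (K + n) G
    ≡⟨ sumℤ-shift⁺ n sK supG ⟩
  sumℤ K F ∎
  where
  open ≡-Reasoning
  G : ℤ → ℕ
  G v = F (v ℤ.+ + n)
  supG : Supp (K + n) G
  supG = Supp-shift (+ n) sK
  eq : ∀ v → F (v ℤ.+ + suc n) ≡ G (v ℤ.+ + 1)
  eq v = cong F (sym (ℤ.+-assoc v (+ 1) (+ n)))
  sup1 : Supp (suc (K + n)) (λ v → G (v ℤ.+ + 1))
  sup1 v le = Supp-shift (+ 1) supG v (subst (_≤ ∣ v ∣) (+-comm 1 (K + n)) le)

sumℤ-shift : ∀ a {K L F} → Supp K F → Supp L (λ v → F (v ℤ.+ a)) → sumℤ L (λ v → F (v ℤ.+ a)) ≡ sumℤ K F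
sumℤ-shift (+ n) sK sL = sumℤ-shift⁺ n sK sL
-- A shift to the left is inverted by a shift to the right, so only the latter needs an induction.
sumℤ-shift a@(-[1+ n ]) {K} {L} {F} sK sL = sym (trans
  (sumℤ-cong K (λ v → sym (cong F (back v))))
  (sumℤ-shift⁺ (suc n) sL (λ v le → trans (cong F (back v)) (sK v le))))
  where
  back : ∀ v → v ℤ.+ + suc n ℤ.+ a ≡ v
  back v = trans (ℤ.+-assoc v (+ suc n) a) (trans (cong (λ z → v ℤ.+ z) (ℤ.+-inverseʳ (+ suc n))) (ℤ.+-identityʳ v))

-- v ↦ - 1 - v exchanges the two halves of the range of sumℤ.
sumℤ-reflect : ∀ K F → sumℤ K (λ v → F (ℤ.- + 1 ℤ.- v)) ≡ sumℤ K F
sumℤ-reflect K F = sumN-cong K (λ i → trans (cong₂ (λ a b → F a + F b) (neg i) (pos i)) (+-comm (F (-[1+ i ])) (F (+ i))))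
  where
  neg : ∀ i → ℤ.- + 1 ℤ.- + i ≡ -[1+ i ]
  neg zero    = refl
  neg (suc i) = refl
  pos : ∀ i → ℤ.- + 1 ℤ.- -[1+ i ] ≡ + i
  pos i = refl

-- The half-open range is invariant under v ↦ -1 - v but not under v ↦ -v, so negation is that
-- reflection composed with a shift by one.
sumℤ-neg : ∀ K {F} → Supp K F → sumℤ K (λ v → F (ℤ.- v)) ≡ sumℤ K F
sumℤ-neg K {F} sK = begin
  sumℤ K (λ v → F (ℤ.- v))              ≡⟨ sumℤ-cong K eq ⟩
  sumℤ K (λ v → R (v ℤ.+ -[1+ 0 ]))          ≡⟨ sumℤ-shift (-[1+ 0 ]) supR (λ v le → trans (sym (eq v)) (supN v le)) ⟩
  sumℤ (K + 1) R                        ≡⟨ sumℤ-reflect (K + 1) F ⟩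
  sumℤ (K + 1) F                        ≡⟨ sumℤ-extend-≤ (m≤m+n K 1) sK ⟩
  sumℤ K F                              ∎
  where
  open ≡-Reasoning
  R : ℤ → ℕ
  R v = F (ℤ.- + 1 ℤ.- v)
  negArg : ∀ v → ℤ.- v ≡ ℤ.- + 1 ℤ.- (v ℤ.+ -[1+ 0 ])
  negArg = ℤR.solve-∀
  shiftArg : ∀ v → ℤ.- + 1 ℤ.- v ≡ ℤ.- (v ℤ.+ + 1)
  shiftArg = ℤR.solve-∀
  eq : ∀ v → F (ℤ.- v) ≡ R (v ℤ.+ -[1+ 0 ])
  eq v = cong F (negArg v)
  supN : Supp K (λ v → F (ℤ.- v))
  supN v le = sK (ℤ.- v) (subst (K ≤_) (sym (ℤ.∣-i∣≡∣i∣ v)) le)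
  supR : Supp (K + 1) R
  supR v le = trans (cong F (shiftArg v)) (Supp-shift (+ 1) supN v le)

-- The half-open range makes this exact without a support hypothesis: -2K ≤ k < 2K consists of 2v
-- and 2v + 1 for -K ≤ v < K.
sumℤ-dissect₂ : ∀ K F → sumℤ (K * 2) F ≡ sumℤ K (λ v → F (+ 2 ℤ.* v) + F (+ 2 ℤ.* v ℤ.+ + 1))
sumℤ-dissect₂ zero    F = refl
sumℤ-dissect₂ (suc K) F = begin
  sumℤ (K * 2) F + (F (+ a) + F (-[1+ a ])) + (F (+ suc a) + F (-[1+ suc a ]))
    ≡⟨ cong (λ s → s + (F (+ a) + F (-[1+ a ])) + (F (+ suc a) + F (-[1+ suc a ]))) (sumℤ-dissect₂ K F) ⟩
  T + (F (+ a) + F (-[1+ a ])) + (F (+ suc a) + F (-[1+ suc a ]))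
    ≡⟨ rearrange T (F (+ a)) (F (-[1+ a ])) (F (+ suc a)) (F (-[1+ suc a ])) ⟩
  T + ((F (+ a) + F (+ suc a)) + (F (-[1+ suc a ]) + F (-[1+ a ])))
    ≡⟨ cong (λ s → T + s) (cong₂ _+_ (cong₂ (λ x y → F x + F y) e₀ e₁) (cong₂ (λ x y → F x + F y) e₂ e₃)) ⟩
  T + ((F (+ 2 ℤ.* + K) + F (+ 2 ℤ.* + K ℤ.+ + 1)) + (F (+ 2 ℤ.* -[1+ K ]) + F (+ 2 ℤ.* -[1+ K ] ℤ.+ + 1))) ∎
  where
  open ≡-Reasoning
  a = K * 2
  T = sumℤ K (λ v → F (+ 2 ℤ.* v) + F (+ 2 ℤ.* v ℤ.+ + 1))
  rearrange : ∀ t x y z w → t + (x + y) + (z + w) ≡ t + ((x + z) + (w + y))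
  rearrange = solve-∀
  cast : + a ≡ + K ℤ.* + 2
  cast = ℤ.pos-* K 2
  r₀ : ∀ x → x ℤ.* + 2 ≡ + 2 ℤ.* x
  r₀ = ℤR.solve-∀
  r₁ : ∀ x → + 1 ℤ.+ x ℤ.* + 2 ≡ + 2 ℤ.* x ℤ.+ + 1
  r₁ = ℤR.solve-∀
  r₂ : ∀ x → ℤ.- (+ 2 ℤ.+ x ℤ.* + 2) ≡ + 2 ℤ.* (ℤ.- (+ 1 ℤ.+ x))
  r₂ = ℤR.solve-∀
  r₃ : ∀ x → ℤ.- (+ 1 ℤ.+ x ℤ.* + 2) ≡ + 2 ℤ.* (ℤ.- (+ 1 ℤ.+ x)) ℤ.+ + 1
  r₃ = ℤR.solve-∀
  e₀ : + a ≡ + 2 ℤ.* + K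
  e₀ = trans cast (r₀ (+ K))
  e₁ : + suc a ≡ + 2 ℤ.* + K ℤ.+ + 1
  e₁ = trans (cong (λ z → + 1 ℤ.+ z) cast) (r₁ (+ K))
  e₂ : -[1+ suc a ] ≡ + 2 ℤ.* -[1+ K ]
  e₂ = trans (cong (λ z → ℤ.- (+ 2 ℤ.+ z)) cast) (r₂ (+ K))
  e₃ : -[1+ a ] ≡ + 2 ℤ.* -[1+ K ] ℤ.+ + 1
  e₃ = trans (cong (λ z → ℤ.- (+ 1 ℤ.+ z)) cast) (r₃ (+ K))

sumℤ-dissect₃ : ∀ K F → sumℤ (K * 3) F ≡
  sumℤ K (λ v → F (+ 3 ℤ.* v) + (F (+ 3 ℤ.* v ℤ.+ + 1) + F (+ 3 ℤ.* v ℤ.+ + 2)))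
sumℤ-dissect₃ zero    F = refl
sumℤ-dissect₃ (suc K) F = begin
  sumℤ (K * 3) F + (F (+ a) + F (-[1+ a ])) + (F (+ (1 + a)) + F (-[1+ 1 + a ])) + (F (+ (2 + a)) + F (-[1+ 2 + a ]))
    ≡⟨ cong (λ s → s + (F (+ a) + F (-[1+ a ])) + (F (+ (1 + a)) + F (-[1+ 1 + a ])) + (F (+ (2 + a)) + F (-[1+ 2 + a ]))) (sumℤ-dissect₃ K F) ⟩
  T + (F (+ a) + F (-[1+ a ])) + (F (+ (1 + a)) + F (-[1+ 1 + a ])) + (F (+ (2 + a)) + F (-[1+ 2 + a ]))
    ≡⟨ rearrange T (F (+ a)) (F (-[1+ a ])) (F (+ (1 + a))) (F (-[1+ 1 + a ])) (F (+ (2 + a))) (F (-[1+ 2 + a ])) ⟩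
  T + ((F (+ a) + (F (+ (1 + a)) + F (+ (2 + a)))) + (F (-[1+ 2 + a ]) + (F (-[1+ 1 + a ]) + F (-[1+ a ]))))
    ≡⟨ cong (λ s → T + s) (cong₂ _+_
         (cong₂ _+_ (cong F e₀) (cong₂ (λ x y → F x + F y) e₁ e₂))
         (cong₂ _+_ (cong F e₃) (cong₂ (λ x y → F x + F y) e₄ e₅))) ⟩
  T + (G (+ K) + G (-[1+ K ])) ∎
  where
  open ≡-Reasoning
  a = K * 3
  G : ℤ → ℕ
  G v = F (+ 3 ℤ.* v) + (F (+ 3 ℤ.* v ℤ.+ + 1) + F (+ 3 ℤ.* v ℤ.+ + 2))
  T = sumℤ K G
  rearrange : ∀ t x y z w p q → t + (x + y) + (z + w) + (p + q) ≡ t + ((x + (z + p)) + (q + (w + y)))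
  rearrange = solve-∀
  cast : + a ≡ + K ℤ.* + 3
  cast = ℤ.pos-* K 3
  r₀ : ∀ x → x ℤ.* + 3 ≡ + 3 ℤ.* x
  r₀ = ℤR.solve-∀
  r₁ : ∀ i x → i ℤ.+ x ℤ.* + 3 ≡ + 3 ℤ.* x ℤ.+ i
  r₁ = ℤR.solve-∀
  r₃ : ∀ x → ℤ.- (+ 3 ℤ.+ x ℤ.* + 3) ≡ + 3 ℤ.* (ℤ.- (+ 1 ℤ.+ x))
  r₃ = ℤR.solve-∀
  r₄ : ∀ x → ℤ.- (+ 2 ℤ.+ x ℤ.* + 3) ≡ + 3 ℤ.* (ℤ.- (+ 1 ℤ.+ x)) ℤ.+ + 1
  r₄ = ℤR.solve-∀
  r₅ : ∀ x → ℤ.- (+ 1 ℤ.+ x ℤ.* + 3) ≡ + 3 ℤ.* (ℤ.- (+ 1 ℤ.+ x)) ℤ.+ + 2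
  r₅ = ℤR.solve-∀
  e₀ : + a ≡ + 3 ℤ.* + K
  e₀ = trans cast (r₀ (+ K))
  e₁ : + (1 + a) ≡ + 3 ℤ.* + K ℤ.+ + 1
  e₁ = trans (cong (λ z → + 1 ℤ.+ z) cast) (r₁ (+ 1) (+ K))
  e₂ : + (2 + a) ≡ + 3 ℤ.* + K ℤ.+ + 2
  e₂ = trans (cong (λ z → + 2 ℤ.+ z) cast) (r₁ (+ 2) (+ K))
  e₃ : -[1+ 2 + a ] ≡ + 3 ℤ.* -[1+ K ]
  e₃ = trans (cong (λ z → ℤ.- (+ 3 ℤ.+ z)) cast) (r₃ (+ K))
  e₄ : -[1+ 1 + a ] ≡ + 3 ℤ.* -[1+ K ] ℤ.+ + 1
  e₄ = trans (cong (λ z → ℤ.- (+ 2 ℤ.+ z)) cast) (r₄ (+ K))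
  e₅ : -[1+ a ] ≡ + 3 ℤ.* -[1+ K ] ℤ.+ + 2
  e₅ = trans (cong (λ z → ℤ.- (+ 1 ℤ.+ z)) cast) (r₅ (+ K))

par : ℕ → Bool
par zero    = false
par (suc n) = not (par n)

not-xor : ∀ a b → not (a xor b) ≡ not a xor b
not-xor false b = refl
not-xor true false = refl
not-xor true true = refl

par-+ : ∀ m n → par (m + n) ≡ par m xor par n
par-+ zero    n = refl
par-+ (suc m) n = trans (cong not (par-+ m n)) (not-xor (par m) (par n))

par-double : ∀ n → par (n + n) ≡ false
par-double n = trans (par-+ n n) (xor-same (par n))

par-sumN : ∀ K h → par (sumN K h) ≡ sum₂ K (λ i → par (h i))
par-sumN zero    h = refl
par-sumN (suc K) h = trans (par-+ (sumN K h) (h K)) (cong (_xor par (h K)) (par-sumN K h))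

par-sumℤ : ∀ K F → par (sumℤ K F) ≡ sumℤ₂ K (λ v → par (F v))
par-sumℤ K F = trans (par-sumN K _) (sum₂-cong K (λ i _ → par-+ (F (+ i)) (F (-[1+ i ]))))

-- A summand on ℤ² carries its own support bound, so that a change of variables is an operation on
-- `Fin²`. By `Σ²-at` any larger bound gives the same sum.
record Fin² : Set where
  field
    fun   : ℤ → ℤ → ℕ
    bnd   : ℕ
    supp₁ : ∀ v y → bnd ≤ ∣ v ∣ → fun v y ≡ 0
    supp₂ : ∀ v y → bnd ≤ ∣ y ∣ → fun v y ≡ 0

open Fin²

Σ² : Fin² → ℕ
Σ² W = sumℤ (bnd W) (λ v → sumℤ (bnd W) (fun W v))

Σ²-at : ∀ W {K} → bnd W ≤ K → sumℤ K (λ v → sumℤ K (fun W v)) ≡ Σ² W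
Σ²-at W {K} le = trans (sumℤ-cong K (λ v → sumℤ-extend-≤ le (supp₂ W v)))
  (sumℤ-extend-≤ le (λ v le′ → sumℤ-zero (bnd W) (λ y → supp₁ W v y le′)))

Σ²-cong : ∀ V W → (∀ v y → fun V v y ≡ fun W v y) → Σ² V ≡ Σ² W
Σ²-cong V W eq = trans (sym (Σ²-at V (m≤m+n (bnd V) (bnd W))))
  (trans (sumℤ-cong K (λ v → sumℤ-cong K (eq v))) (Σ²-at W (m≤n+m (bnd W) (bnd V))))
  where K = bnd V + bnd W

Σ²-zero : ∀ W → (∀ v y → fun W v y ≡ 0) → Σ² W ≡ 0
Σ²-zero W eq = sumℤ-zero (bnd W) (λ v → sumℤ-zero (bnd W) (eq v))

swap : Fin² → Fin²
swap W = record
  { fun   = λ v y → fun W y v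
  ; bnd   = bnd W
  ; supp₁ = λ v y → supp₂ W y v
  ; supp₂ = λ v y → supp₁ W y v }

Σ²-swap : ∀ W → Σ² (swap W) ≡ Σ² W
Σ²-swap W = sym (sumℤ-swap (bnd W) (bnd W) (fun W))

shear : (ℤ → ℤ) → Fin² → Fin²
shear a W = record
  { fun   = λ v y → fun W v (y ℤ.+ a v)
  ; bnd   = bnd W + M
  ; supp₁ = λ v y le → supp₁ W v _ (≤-trans (m≤m+n (bnd W) M) le)
  ; supp₂ = s₂ }
  where
  -- One bound for the shifts of all rows that meet the support; a sum of absolute values dominates
  -- each of them.
  M = sumℤ (bnd W) (λ v → ∣ a v ∣)
  a≤M : ∀ v → ∣ v ∣ < bnd W → ∣ a v ∣ ≤ M
  a≤M (+ i)      lt = ≤-trans (m≤m+n _ _) (term≤sumN (bnd W) (λ i → ∣ a (+ i) ∣ + ∣ a (-[1+ i ]) ∣) i lt)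
  a≤M (-[1+ i ]) lt = ≤-trans (m≤n+m _ _) (term≤sumN (bnd W) (λ i → ∣ a (+ i) ∣ + ∣ a (-[1+ i ]) ∣) i (<⇒≤ lt))
  s₂ : ∀ v y → bnd W + M ≤ ∣ y ∣ → fun W v (y ℤ.+ a v) ≡ 0
  s₂ v y le with bnd W ≤? ∣ v ∣
  ... | yes le′ = supp₁ W v _ le′
  ... | no ¬le  = supp₂ W v _ (+-cancelʳ-≤ M (bnd W) _ (≤-trans le
          (≤-trans (∣v∣≤∣v+a∣+∣a∣ y (a v)) (+-monoʳ-≤ ∣ y ℤ.+ a v ∣ (a≤M v (≰⇒> ¬le))))))

Σ²-shear : ∀ a W → Σ² (shear a W) ≡ Σ² W
Σ²-shear a W = trans
  (sumℤ-cong K (λ v → sumℤ-shift (a v) (λ y le → supp₂ W v y (≤-trans B≤K le)) (supp₂ (shear a W) v)))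
  (Σ²-at W B≤K)
  where
  K = bnd (shear a W)
  B≤K : bnd W ≤ K
  B≤K = m≤m+n (bnd W) (sumℤ (bnd W) (λ v → ∣ a v ∣))

negate : Fin² → Fin²
negate W = record
  { fun   = λ v y → fun W v (ℤ.- y)
  ; bnd   = bnd W
  ; supp₁ = λ v y → supp₁ W v (ℤ.- y)
  ; supp₂ = λ v y le → supp₂ W v (ℤ.- y) (subst (bnd W ≤_) (sym (ℤ.∣-i∣≡∣i∣ y)) le) }

Σ²-negate : ∀ W → Σ² (negate W) ≡ Σ² W
Σ²-negate W = sumℤ-cong (bnd W) (λ v → sumℤ-neg (bnd W) (supp₂ W v))

pull : (φ : ℤ → ℤ) (c : ℕ) → (∀ v → ∣ v ∣ ≤ ∣ φ v ∣ + c) → Fin² → Fin²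
pull φ c grow W = record
  { fun   = λ v → fun W (φ v)
  ; bnd   = bnd W + c
  ; supp₁ = λ v y le → supp₁ W (φ v) y (+-cancelʳ-≤ c (bnd W) _ (≤-trans le (grow v)))
  ; supp₂ = λ v y le → supp₂ W (φ v) y (≤-trans (m≤m+n (bnd W) c) le) }

reflect : Fin² → Fin²
reflect = pull (λ v → ℤ.- + 1 ℤ.- v) 1 grow
  where
  grow : ∀ v → ∣ v ∣ ≤ ∣ ℤ.- + 1 ℤ.- v ∣ + 1
  grow (+ zero)   = z≤n
  grow (+ suc n)  = ≤-trans (n≤1+n _) (m≤m+n _ 1)
  grow (-[1+ n ]) = ≤-reflexive (+-comm 1 n)

Σ²-reflect : ∀ W → Σ² (reflect W) ≡ Σ² W
Σ²-reflect W = trans (sumℤ-reflect K (λ v → sumℤ K (fun W v))) (Σ²-at W (m≤m+n (bnd W) 1))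
  where K = bnd W + 1

affine : ℕ → ℕ → Fin² → Fin²
affine k b = pull (λ v → + suc k ℤ.* v ℤ.+ + b) b grow
  where
  grow : ∀ v → ∣ v ∣ ≤ ∣ + suc k ℤ.* v ℤ.+ + b ∣ + b
  grow v = ≤-trans (≤-trans (m≤n*m ∣ v ∣ (suc k)) (≤-reflexive (sym (ℤ.abs-* (+ suc k) v))))
    (∣v∣≤∣v+a∣+∣a∣ (+ suc k ℤ.* v) (+ b))

Σ²-dissect₂ : ∀ W → Σ² W ≡ Σ² (affine 1 0 W) + Σ² (affine 1 1 W)
Σ²-dissect₂ W = begin
  Σ² W                                                       ≡⟨ sym (Σ²-at W B≤K) ⟩
  sumℤ K T                                                      ≡⟨ sym (sumℤ-extend-≤ (m≤m*n K 2) suppT) ⟩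
  sumℤ (K * 2) T                                                ≡⟨ sumℤ-dissect₂ K T ⟩
  sumℤ K (λ v → T (+ 2 ℤ.* v) + T (+ 2 ℤ.* v ℤ.+ + 1))          ≡⟨ sumℤ-+ K (λ v → T (+ 2 ℤ.* v)) (λ v → T (+ 2 ℤ.* v ℤ.+ + 1)) ⟩
  sumℤ K (λ v → T (+ 2 ℤ.* v)) + sumℤ K (λ v → T (+ 2 ℤ.* v ℤ.+ + 1))
    ≡⟨ cong₂ _+_ (trans (sumℤ-cong K (λ v → cong T (sym (ℤ.+-identityʳ (+ 2 ℤ.* v)))))
                        (Σ²-at (affine 1 0 W) (+-monoʳ-≤ (bnd W) z≤n)))
                 (Σ²-at (affine 1 1 W) ≤-refl) ⟩
  Σ² (affine 1 0 W) + Σ² (affine 1 1 W)                      ∎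
  where
  open ≡-Reasoning
  K = bnd W + 1
  B≤K = m≤m+n (bnd W) 1
  T : ℤ → ℕ
  T v = sumℤ K (fun W v)
  suppT : Supp K T
  suppT v le = sumℤ-zero K (λ y → supp₁ W v y (≤-trans B≤K le))

Σ²-dissect₃ : ∀ W → Σ² W ≡ Σ² (affine 2 0 W) + (Σ² (affine 2 1 W) + Σ² (affine 2 2 W))
Σ²-dissect₃ W = begin
  Σ² W                                                       ≡⟨ sym (Σ²-at W B≤K) ⟩
  sumℤ K T                                                      ≡⟨ sym (sumℤ-extend-≤ (m≤m*n K 3) suppT) ⟩
  sumℤ (K * 3) T                                                ≡⟨ sumℤ-dissect₃ K T ⟩
  sumℤ K (λ v → T₀ v + (T₁ v + T₂ v))                           ≡⟨ trans (sumℤ-+ K T₀ (λ v → T₁ v + T₂ v)) (cong (λ s → sumℤ K T₀ + s) (sumℤ-+ K T₁ T₂)) ⟩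
  sumℤ K T₀ + (sumℤ K T₁ + sumℤ K T₂)
    ≡⟨ cong₂ _+_ (trans (sumℤ-cong K (λ v → cong T (sym (ℤ.+-identityʳ (+ 3 ℤ.* v)))))
                        (Σ²-at (affine 2 0 W) (+-monoʳ-≤ (bnd W) z≤n)))
         (cong₂ _+_ (Σ²-at (affine 2 1 W) (+-monoʳ-≤ (bnd W) (s≤s z≤n)))
                    (Σ²-at (affine 2 2 W) ≤-refl)) ⟩
  Σ² (affine 2 0 W) + (Σ² (affine 2 1 W) + Σ² (affine 2 2 W)) ∎
  where
  open ≡-Reasoning
  K = bnd W + 2
  B≤K = m≤m+n (bnd W) 2
  T T₀ T₁ T₂ : ℤ → ℕ
  T v = sumℤ K (fun W v)
  T₀ v = T (+ 3 ℤ.* v)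
  T₁ v = T (+ 3 ℤ.* v ℤ.+ + 1)
  T₂ v = T (+ 3 ℤ.* v ℤ.+ + 2)
  suppT : Supp K T
  suppT v le = sumℤ-zero K (λ y → supp₁ W v y (≤-trans B≤K le))

-- The range pairs K with -K - 1, and evenness turns this pair into T(K) + T(K + 1), so the sum
-- telescopes modulo 2.
par-sumℤ-even : ∀ K {T} → Supp K T → (∀ v → T (ℤ.- v) ≡ T v) → par (sumℤ K T) ≡ par (T (+ 0))
par-sumℤ-even K {T} supp even = begin
  par (sumℤ K T)                          ≡⟨ telescope K ⟩
  par (T (+ 0)) xor par (T (+ K))      ≡⟨ cong (λ t → par (T (+ 0)) xor par t) (supp (+ K) ≤-refl) ⟩
  par (T (+ 0)) xor false              ≡⟨ xor-identityʳ _ ⟩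
  par (T (+ 0))                        ∎
  where
  open ≡-Reasoning
  telescope : ∀ K → par (sumℤ K T) ≡ par (T (+ 0)) xor par (T (+ K))
  telescope zero    = sym (xor-same (par (T (+ 0))))
  telescope (suc K) = begin
    par (sumℤ K T + (T (+ K) + T (-[1+ K ])))
      ≡⟨ par-+ (sumℤ K T) _ ⟩
    par (sumℤ K T) xor par (T (+ K) + T (-[1+ K ]))
      ≡⟨ cong₂ _xor_ (telescope K) (trans (par-+ (T (+ K)) _) (cong (λ t → par (T (+ K)) xor par t) (even (+ suc K)))) ⟩
    (par (T (+ 0)) xor par (T (+ K))) xor (par (T (+ K)) xor par (T (+ suc K)))
      ≡⟨ xor-merge (par (T (+ 0))) _ _ ⟩
    par (T (+ 0)) xor par (T (+ suc K)) ∎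

par-sumℤ-reflect : ∀ K {T} → (∀ v → T (ℤ.- + 1 ℤ.- v) ≡ T v) → par (sumℤ K T) ≡ false
par-sumℤ-reflect zero    sym′ = refl
par-sumℤ-reflect (suc K) {T} sym′ = trans (par-+ (sumℤ K T) _) (cong₂ _xor_ (par-sumℤ-reflect K sym′)
  (trans (cong (λ t → par (t + T (-[1+ K ]))) (sym (sym′ (+ K)))) (trans (cong (λ v → par (T v + T (-[1+ K ]))) (neg K)) (par-double (T (-[1+ K ]))))))
  where
  neg : ∀ i → ℤ.- + 1 ℤ.- + i ≡ -[1+ i ]
  neg zero    = refl
  neg (suc i) = refl

-- The involution fixes only the origin. The row sums are even in v, which leaves the row v = 0, and
-- that row is even in y.
par-Σ²-central : ∀ W → (∀ v y → fun W (ℤ.- v) (ℤ.- y) ≡ fun W v y) → fun W (+ 0) (+ 0) ≡ 0 → par (Σ² W) ≡ false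
par-Σ²-central W central zero₀ = trans
  (par-sumℤ-even B (λ v le → sumℤ-zero B (λ y → supp₁ W v y le)) evenT)
  (trans (par-sumℤ-even B (supp₂ W (+ 0)) (central (+ 0))) (cong par zero₀))
  where
  B = bnd W
  evenT : ∀ v → sumℤ B (fun W (ℤ.- v)) ≡ sumℤ B (fun W v)
  evenT v = trans (sym (sumℤ-neg B (supp₂ W (ℤ.- v)))) (sumℤ-cong B (central v))

-- Here the involution has no fixed point, since v = -1 - v has no integer solution.
par-Σ²-reflect : ∀ W → (∀ v y → fun W (ℤ.- + 1 ℤ.- v) (ℤ.- y) ≡ fun W v y) → par (Σ² W) ≡ false
par-Σ²-reflect W central = par-sumℤ-reflect B
  (λ v → trans (sym (sumℤ-neg B (supp₂ W (ℤ.- + 1 ℤ.- v)))) (sumℤ-cong B (central v)))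
  where B = bnd W

-- Binary forms of discriminant -23

record Weight : Set where
  field
    wt   : ℤ → ℕ
    cut  : ℕ
    supp : Supp cut wt

open Weight

-- For the indicator of m this is the indicator of m/c, and zero if c does not divide m. The terms
-- at m/2 and m/4 of a Hecke relation are thus expressed without division.
dilate : (c : ℕ) .{{_ : NonZero c}} → Weight → Weight
dilate c Φ = record
  { wt   = λ z → wt Φ (+ c ℤ.* z)
  ; cut  = cut Φ
  ; supp = λ z le → supp Φ (+ c ℤ.* z)
      (≤-trans le (≤-trans (m≤n*m ∣ z ∣ c) (≤-reflexive (sym (ℤ.abs-* (+ c) z))))) }

-- Definiteness is kept only as growth in each variable, which suffices for finite counts and admits
-- the inhomogeneous `ν` beside the quadratic forms.
record Form : Set where
  field
    val   : ℤ → ℤ → ℤ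
    const : ℕ
    const≢0 : NonZero const
    grow₁ : ∀ v y → ∣ v ∣ ≤ const * ∣ val v y ∣
    grow₂ : ∀ v y → ∣ y ∣ ≤ const * ∣ val v y ∣

open Form

infix 8 _⟪_⟫
-- For the indicator of m, the sum `Σ²` of this is the number of representations of m.
_⟪_⟫ : Weight → Form → Fin²
Φ ⟪ q ⟫ = record
  { fun   = λ v y → wt Φ (val q v y)
  ; bnd   = const q * cut Φ
  ; supp₁ = λ v y le → supp Φ _ (*-cancelˡ-≤ (const q) {{const≢0 q}} (≤-trans le (grow₁ q v y)))
  ; supp₂ = λ v y le → supp Φ _ (*-cancelˡ-≤ (const q) {{const≢0 q}} (≤-trans le (grow₂ q v y))) }

square-abs : ∀ x → x ℤ.* x ≡ + (∣ x ∣ * ∣ x ∣)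
square-abs (+ n)      = sym (ℤ.pos-* n n)
square-abs (-[1+ n ]) = refl

-- Used once per variable, in the role of `Y`, after completing the square. The form `suc b` keeps
-- the coefficient of Y² positive, so the arguments 22, 137, 68 and 45 stand for 23, 138, 69 and 46.
squares-bound : ∀ z X Y a b → + 24 ℤ.* z ≡ + a ℤ.* (X ℤ.* X) ℤ.+ + suc b ℤ.* (Y ℤ.* Y) → ∣ Y ∣ ≤ 24 * ∣ z ∣
squares-bound z X Y a b eq = begin
  ∣ Y ∣                                  ≤⟨ n≤n*n ∣ Y ∣ ⟩
  ∣ Y ∣ * ∣ Y ∣                          ≤⟨ m≤n*m _ (suc b) ⟩
  suc b * (∣ Y ∣ * ∣ Y ∣)                ≤⟨ m≤n+m _ (a * (∣ X ∣ * ∣ X ∣)) ⟩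
  a * (∣ X ∣ * ∣ X ∣) + suc b * (∣ Y ∣ * ∣ Y ∣) ≡⟨ cong ∣_∣ (sym cast) ⟩
  ∣ + 24 ℤ.* z ∣                         ≡⟨ ℤ.abs-* (+ 24) z ⟩
  24 * ∣ z ∣                             ∎
  where
  open ≤-Reasoning
  n≤n*n : ∀ n → n ≤ n * n
  n≤n*n zero    = z≤n
  n≤n*n (suc n) = m≤m*n (suc n) (suc n)
  cast : + 24 ℤ.* z ≡ + (a * (∣ X ∣ * ∣ X ∣) + suc b * (∣ Y ∣ * ∣ Y ∣))
  cast = trans eq (cong₂ (λ s t → s ℤ.+ t)
    (trans (cong (+ a ℤ.*_) (square-abs X)) (sym (ℤ.pos-* a _)))
    (trans (cong (+ suc b ℤ.*_) (square-abs Y)) (sym (ℤ.pos-* (suc b) _))))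

fᵥ gᵥ hᵥ : ℤ → ℤ → ℤ
fᵥ v y = v ℤ.* v ℤ.- v ℤ.* y ℤ.+ + 6 ℤ.* (y ℤ.* y)
gᵥ v y = + 2 ℤ.* (v ℤ.* v) ℤ.- + 5 ℤ.* (v ℤ.* y) ℤ.+ + 6 ℤ.* (y ℤ.* y)
hᵥ v y = + 2 ℤ.* (v ℤ.* v) ℤ.- v ℤ.* y ℤ.+ + 3 ℤ.* (y ℤ.* y)

κ : ∀ {n} → ℕ → Polynomial n
κ c = con (+ c)

fₚ gₚ hₚ : ∀ {n} → Polynomial n → Polynomial n → Polynomial n
fₚ v y = v :* v :- v :* y :+ κ 6 :* (y :* y)
gₚ v y = κ 2 :* (v :* v) :- κ 5 :* (v :* y) :+ κ 6 :* (y :* y)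
hₚ v y = κ 2 :* (v :* v) :- v :* y :+ κ 3 :* (y :* y)

𝔣 𝔤 𝔥 : Form
𝔣 = record
  { val = fᵥ ; const = 24 ; const≢0 = _
  ; grow₁ = λ v y → squares-bound (fᵥ v y) (+ 12 ℤ.* y ℤ.- v) v 1 22
      (solve 2 (λ v y → let x = κ 12 :* y :- v in
        κ 24 :* fₚ v y := κ 1 :* (x :* x) :+ κ 23 :* (v :* v)) refl v y)
  ; grow₂ = λ v y → squares-bound (fᵥ v y) (+ 2 ℤ.* v ℤ.- y) y 6 137
      (solve 2 (λ v y → let x = κ 2 :* v :- y in
        κ 24 :* fₚ v y := κ 6 :* (x :* x) :+ κ 138 :* (y :* y)) refl v y) }
𝔤 = record
  { val = gᵥ ; const = 24 ; const≢0 = _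
  ; grow₁ = λ v y → squares-bound (gᵥ v y) (+ 12 ℤ.* y ℤ.- + 5 ℤ.* v) v 1 22
      (solve 2 (λ v y → let x = κ 12 :* y :- κ 5 :* v in
        κ 24 :* gₚ v y := κ 1 :* (x :* x) :+ κ 23 :* (v :* v)) refl v y)
  ; grow₂ = λ v y → squares-bound (gᵥ v y) (+ 4 ℤ.* v ℤ.- + 5 ℤ.* y) y 3 68
      (solve 2 (λ v y → let x = κ 4 :* v :- κ 5 :* y in
        κ 24 :* gₚ v y := κ 3 :* (x :* x) :+ κ 69 :* (y :* y)) refl v y) }
𝔥 = record
  { val = hᵥ ; const = 24 ; const≢0 = _
  ; grow₁ = λ v y → squares-bound (hᵥ v y) (+ 6 ℤ.* y ℤ.- v) v 2 45
      (solve 2 (λ v y → let x = κ 6 :* y :- v in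
        κ 24 :* hₚ v y := κ 2 :* (x :* x) :+ κ 46 :* (v :* v)) refl v y)
  ; grow₂ = λ v y → squares-bound (hᵥ v y) (+ 4 ℤ.* v ℤ.- y) y 3 68
      (solve 2 (λ v y → let x = κ 4 :* v :- y in
        κ 24 :* hₚ v y := κ 3 :* (x :* x) :+ κ 69 :* (y :* y)) refl v y) }

∣k∣≤ω : ∀ k → ∣ k ∣ ≤ ω k
∣k∣≤ω (+ zero)   = z≤n
∣k∣≤ω (+ suc n)  = ≤-trans (m≤m*n (suc n) (suc n)) (m≤m+n _ _)
∣k∣≤ω (-[1+ n ]) = ≤-trans (m≤m*n (suc n) (suc n)) (m≤m+n _ _)

2*tri : ∀ n → + 2 ℤ.* + tri n ≡ + n ℤ.* (+ n ℤ.+ + 1)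
2*tri zero    = refl
2*tri (suc n) = trans (ℤ.*-distribˡ-+ (+ 2) (+ suc n) (+ tri n))
  (trans (cong (λ t → + 2 ℤ.* + suc n ℤ.+ t) (2*tri n)) (step (+ n)))
  where
  step : ∀ x → + 2 ℤ.* (+ 1 ℤ.+ x) ℤ.+ x ℤ.* (x ℤ.+ + 1) ≡ (+ 1 ℤ.+ x) ℤ.* ((+ 1 ℤ.+ x) ℤ.+ + 1)
  step = ℤR.solve-∀

2*ω : ∀ k → + 2 ℤ.* + ω k ≡ k ℤ.* (+ 3 ℤ.* k ℤ.+ + 1)
2*ω (+ n) = trans (cong (λ s → + 2 ℤ.* (s ℤ.+ + tri n)) (ℤ.pos-* n n))
  (trans (ℤ.*-distribˡ-+ (+ 2) (+ n ℤ.* + n) (+ tri n))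
  (trans (cong (λ t → + 2 ℤ.* (+ n ℤ.* + n) ℤ.+ t) (2*tri n)) (step (+ n))))
  where
  step : ∀ x → + 2 ℤ.* (x ℤ.* x) ℤ.+ x ℤ.* (x ℤ.+ + 1) ≡ x ℤ.* (+ 3 ℤ.* x ℤ.+ + 1)
  step = ℤR.solve-∀
2*ω (-[1+ n ]) = trans (cong (λ s → + 2 ℤ.* (s ℤ.+ + tri n)) (ℤ.pos-* (suc n) (suc n)))
  (trans (ℤ.*-distribˡ-+ (+ 2) (+ suc n ℤ.* + suc n) (+ tri n))
  (trans (cong (λ t → + 2 ℤ.* (+ suc n ℤ.* + suc n) ℤ.+ t) (2*tri n)) (step (+ n))))
  where
  step : ∀ x → + 2 ℤ.* ((+ 1 ℤ.+ x) ℤ.* (+ 1 ℤ.+ x)) ℤ.+ x ℤ.* (x ℤ.+ + 1) ≡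
    (ℤ.- (+ 1 ℤ.+ x)) ℤ.* (+ 3 ℤ.* (ℤ.- (+ 1 ℤ.+ x)) ℤ.+ + 1)
  step = ℤR.solve-∀

-- The exponents of q f₁f₂₃ in the double pentagonal expansion; `suc` is the factor q.
νᵥ : ℤ → ℤ → ℤ
νᵥ k j = + suc (ω k + 23 * ω j)

2*ν : ∀ k j → + 2 ℤ.* νᵥ k j ≡ + 2 ℤ.+ k ℤ.* (+ 3 ℤ.* k ℤ.+ + 1) ℤ.+ + 23 ℤ.* (j ℤ.* (+ 3 ℤ.* j ℤ.+ + 1))
2*ν k j = begin
  + 2 ℤ.* νᵥ k j
    ≡⟨ cong (λ z → + 2 ℤ.* (+ 1 ℤ.+ (+ ω k ℤ.+ z))) (ℤ.pos-* 23 (ω j)) ⟩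
  + 2 ℤ.* (+ 1 ℤ.+ (+ ω k ℤ.+ + 23 ℤ.* + ω j))
    ≡⟨ step (+ ω k) (+ ω j) ⟩
  + 2 ℤ.+ + 2 ℤ.* + ω k ℤ.+ + 23 ℤ.* (+ 2 ℤ.* + ω j)
    ≡⟨ cong₂ (λ a b → + 2 ℤ.+ a ℤ.+ + 23 ℤ.* b) (2*ω k) (2*ω j) ⟩
  + 2 ℤ.+ k ℤ.* (+ 3 ℤ.* k ℤ.+ + 1) ℤ.+ + 23 ℤ.* (j ℤ.* (+ 3 ℤ.* j ℤ.+ + 1)) ∎
  where
  open ≡-Reasoning
  step : ∀ a b → + 2 ℤ.* (+ 1 ℤ.+ (a ℤ.+ + 23 ℤ.* b)) ≡ + 2 ℤ.+ + 2 ℤ.* a ℤ.+ + 23 ℤ.* (+ 2 ℤ.* b)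
  step = ℤR.solve-∀

ν : Form
ν = record
  { val = νᵥ ; const = 1 ; const≢0 = _
  ; grow₁ = λ k j → ≤-trans (∣k∣≤ω k) (≤-trans (m≤m+n (ω k) (23 * ω j)) (≤-trans (n≤1+n _) (m≤n*m _ 1)))
  ; grow₂ = λ k j → ≤-trans (∣k∣≤ω j) (≤-trans (m≤n*m (ω j) 23) (≤-trans (m≤n+m (23 * ω j) (ω k))
      (≤-trans (n≤1+n _) (m≤n*m _ 1)))) }

-- The part of W on the residue class v ≡ 2i + b modulo 6.
class : ℕ → ℕ → Fin² → Fin²
class b i W = affine 2 i (affine 1 b W)

Σ²-classes : ∀ W → Σ² W ≡
  (Σ² (class 0 0 W) + (Σ² (class 0 1 W) + Σ² (class 0 2 W))) +
  (Σ² (class 1 0 W) + (Σ² (class 1 1 W) + Σ² (class 1 2 W)))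
Σ²-classes W = trans (Σ²-dissect₂ W) (cong₂ _+_ (Σ²-dissect₃ (affine 1 0 W)) (Σ²-dissect₃ (affine 1 1 W)))

-- The symmetry sends the class of v modulo 6 to its negative: it preserves 0 and 3 and exchanges 2
-- with 4 and 1 with 5. In the coordinate inside a class it is v ↦ -v for class 0 and v ↦ -1 - v for
-- the others.
module Central (W : Fin²) (central : ∀ v y → fun W (ℤ.- v) (ℤ.- y) ≡ fun W v y) where

  class-0 : fun W (+ 0) (+ 0) ≡ 0 → par (Σ² (class 0 0 W)) ≡ false
  class-0 zero₀ = par-Σ²-central (class 0 0 W)
    (λ v y → trans (cong (λ z → fun W z (ℤ.- y)) (eq v)) (central (+ 2 ℤ.* (+ 3 ℤ.* v ℤ.+ + 0) ℤ.+ + 0) y)) zero₀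
    where
    eq : ∀ v → + 2 ℤ.* (+ 3 ℤ.* (ℤ.- v) ℤ.+ + 0) ℤ.+ + 0 ≡ ℤ.- (+ 2 ℤ.* (+ 3 ℤ.* v ℤ.+ + 0) ℤ.+ + 0)
    eq = ℤR.solve-∀

  class-3 : par (Σ² (class 1 1 W)) ≡ false
  class-3 = par-Σ²-reflect (class 1 1 W)
    (λ v y → trans (cong (λ z → fun W z (ℤ.- y)) (eq v)) (central (+ 2 ℤ.* (+ 3 ℤ.* v ℤ.+ + 1) ℤ.+ + 1) y))
    where
    eq : ∀ v → + 2 ℤ.* (+ 3 ℤ.* (ℤ.- + 1 ℤ.- v) ℤ.+ + 1) ℤ.+ + 1 ≡ ℤ.- (+ 2 ℤ.* (+ 3 ℤ.* v ℤ.+ + 1) ℤ.+ + 1)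
    eq = ℤR.solve-∀

  class-4≡2 : Σ² (class 0 2 W) ≡ Σ² (class 0 1 W)
  class-4≡2 = trans (sym (trans (Σ²-reflect (negate V)) (Σ²-negate V)))
    (Σ²-cong (reflect (negate V)) (class 0 1 W)
      (λ v y → trans (cong (λ z → fun W z (ℤ.- y)) (eq v)) (central (+ 2 ℤ.* (+ 3 ℤ.* v ℤ.+ + 1) ℤ.+ + 0) y)))
    where
    V = class 0 2 W
    eq : ∀ v → + 2 ℤ.* (+ 3 ℤ.* (ℤ.- + 1 ℤ.- v) ℤ.+ + 2) ℤ.+ + 0 ≡ ℤ.- (+ 2 ℤ.* (+ 3 ℤ.* v ℤ.+ + 1) ℤ.+ + 0)
    eq = ℤR.solve-∀

  class-5≡1 : Σ² (class 1 2 W) ≡ Σ² (class 1 0 W)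
  class-5≡1 = trans (sym (trans (Σ²-reflect (negate V)) (Σ²-negate V)))
    (Σ²-cong (reflect (negate V)) (class 1 0 W)
      (λ v y → trans (cong (λ z → fun W z (ℤ.- y)) (eq v)) (central (+ 2 ℤ.* (+ 3 ℤ.* v ℤ.+ + 0) ℤ.+ + 1) y)))
    where
    V = class 1 2 W
    eq : ∀ v → + 2 ℤ.* (+ 3 ℤ.* (ℤ.- + 1 ℤ.- v) ℤ.+ + 2) ℤ.+ + 1 ≡ ℤ.- (+ 2 ℤ.* (+ 3 ℤ.* v ℤ.+ + 0) ℤ.+ + 1)
    eq = ℤR.solve-∀

f-central : ∀ v y → fᵥ (ℤ.- v) (ℤ.- y) ≡ fᵥ v y
f-central = solve 2 (λ v y → fₚ (:- v) (:- y) := fₚ v y) refl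

g-central : ∀ v y → gᵥ (ℤ.- v) (ℤ.- y) ≡ gᵥ v y
g-central = solve 2 (λ v y → gₚ (:- v) (:- y) := gₚ v y) refl

-- The pairs (u, v) counted through f and h

module _ (Φ : Weight) where

  private
    F G H N : Fin²
    F = Φ ⟪ 𝔣 ⟫
    G = Φ ⟪ 𝔤 ⟫
    H = Φ ⟪ 𝔥 ⟫
    N = Φ ⟪ ν ⟫

  F-central : ∀ v y → fun F (ℤ.- v) (ℤ.- y) ≡ fun F v y
  F-central v y = cong (wt Φ) (f-central v y)

  G-central : ∀ v y → fun G (ℤ.- v) (ℤ.- y) ≡ fun G v y
  G-central v y = cong (wt Φ) (g-central v y)

  -- f(2w, y) = g(2w, w - y)
  F≡G-even : ∀ i → Σ² (class 0 i F) ≡ Σ² (class 0 i G)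
  F≡G-even i = trans (Σ²-cong (class 0 i F) (shear a (negate V)) eq)
    (trans (Σ²-shear a (negate V)) (Σ²-negate V))
    where
    V = class 0 i G
    a : ℤ → ℤ
    a v = ℤ.- (+ 3 ℤ.* v ℤ.+ + i)
    eq : ∀ v y → fun (class 0 i F) v y ≡ fun (shear a (negate V)) v y
    eq v y = cong (wt Φ) (solve 2 (λ w y → let V = κ 2 :* w :+ κ 0 in
      fₚ V y := gₚ V (:- (y :+ (:- w)))) refl (+ 3 ℤ.* v ℤ.+ + i) y)

  -- f(3w, y) = g(3w, y + w)
  F≡G-3 : Σ² (class 1 1 F) ≡ Σ² (class 1 1 G)
  F≡G-3 = trans (Σ²-cong (class 1 1 F) (shear a V) eq) (Σ²-shear a V)
    where
    V = class 1 1 G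
    a : ℤ → ℤ
    a v = + 2 ℤ.* v ℤ.+ + 1
    eq : ∀ v y → fun (class 1 1 F) v y ≡ fun (shear a V) v y
    eq v y = cong (wt Φ) (solve 2 (λ v y → let V = κ 2 :* (κ 3 :* v :+ κ 1) :+ κ 1 in
      fₚ V y := gₚ V (y :+ (κ 2 :* v :+ κ 1))) refl v y)

  -- g(v + y, y) = h(v, y)
  G≡H : Σ² G ≡ Σ² H
  G≡H = sym (trans (Σ²-cong H (swap (shear (λ y → y) (swap G))) eq)
    (trans (Σ²-swap (shear (λ y → y) (swap G))) (trans (Σ²-shear (λ y → y) (swap G)) (Σ²-swap G))))
    where
    eq : ∀ v y → fun H v y ≡ fun (swap (shear (λ y → y) (swap G))) v y
    eq v y = cong (wt Φ) (solve 2 (λ v y → hₚ v y := gₚ (v :+ y) y) refl v y)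

  -- With u = 6k + 1 and v = 6j + 1, either u ≡ v or u ≡ -5v modulo 12, and
  -- (u² + 23v²)/24 is f(v, (v - u)/12) or g(v, (u + 5v)/12) accordingly.
  N≡F+G : Σ² N ≡ Σ² (class 1 0 F) + Σ² (class 1 0 G)
  N≡F+G = begin
    Σ² N                                    ≡⟨ sym (trans (Σ²-shear (λ j → j) (swap N)) (Σ²-swap N)) ⟩
    Σ² N′                                   ≡⟨ sym (Σ²-swap N′) ⟩
    Σ² (swap N′)                            ≡⟨ Σ²-dissect₂ (swap N′) ⟩
    Σ² N₀ + Σ² N₁                           ≡⟨ cong₂ _+_ (sym (Σ²-swap N₀)) (sym (Σ²-swap N₁)) ⟩
    Σ² (swap N₀) + Σ² (swap N₁)
      ≡⟨ cong₂ _+_ (Σ²-cong (swap N₀) (negate (class 1 0 F)) eq₀) (Σ²-cong (swap N₁) (shear a (class 1 0 G)) eq₁) ⟩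
    Σ² (negate (class 1 0 F)) + Σ² (shear a (class 1 0 G))
      ≡⟨ cong₂ _+_ (Σ²-negate (class 1 0 F)) (Σ²-shear a (class 1 0 G)) ⟩
    Σ² (class 1 0 F) + Σ² (class 1 0 G)     ∎
    where
    open ≡-Reasoning
    -- The second variable is now s = k - j. Since u - v = 6s, the parity of s decides between the
    -- two cases.
    N′ = shear (λ j → j) (swap N)
    N₀ = affine 1 0 (swap N′)
    N₁ = affine 1 1 (swap N′)
    a : ℤ → ℤ
    a j = + 3 ℤ.* j ℤ.+ + 1
    νₚ : ∀ {n} → Polynomial n → Polynomial n → Polynomial n
    νₚ k j = κ 2 :+ k :* (κ 3 :* k :+ κ 1) :+ κ 23 :* (j :* (κ 3 :* j :+ κ 1))
    eq₀ : ∀ j s → fun (swap N₀) j s ≡ fun (negate (class 1 0 F)) j s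
    eq₀ j s = cong (wt Φ) (ℤ.*-cancelˡ-≡ (+ 2) _ _ (trans (2*ν (+ 2 ℤ.* s ℤ.+ + 0 ℤ.+ j) j)
      (solve 2 (λ j s → νₚ (κ 2 :* s :+ κ 0 :+ j) j :=
        κ 2 :* fₚ (κ 2 :* (κ 3 :* j :+ κ 0) :+ κ 1) (:- s)) refl j s)))
    eq₁ : ∀ j s → fun (swap N₁) j s ≡ fun (shear a (class 1 0 G)) j s
    eq₁ j s = cong (wt Φ) (ℤ.*-cancelˡ-≡ (+ 2) _ _ (trans (2*ν (+ 2 ℤ.* s ℤ.+ + 1 ℤ.+ j) j)
      (solve 2 (λ j s → νₚ (κ 2 :* s :+ κ 1 :+ j) j :=
        κ 2 :* gₚ (κ 2 :* (κ 3 :* j :+ κ 0) :+ κ 1) (s :+ (κ 3 :* j :+ κ 1))) refl j s)))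

  -- Half of what the classes of v not prime to 6 contribute to f and g together; class 2 enters
  -- twice, once on behalf of class 4.
  excess : ℕ
  excess = Σ² (class 0 0 F) + Σ² (class 1 1 F) + (Σ² (class 0 1 F) + Σ² (class 0 1 F))

  -- The classes 1 and 5 have equal sums and class 1 gives `N`, while f and g agree on the remaining
  -- classes. Equality in ℕ matters: modulo 2 the statement would lose `N`.
  F+H≡2N+2e : Σ² F + Σ² H ≡ 2 * (Σ² N + excess)
  F+H≡2N+2e = begin
    Σ² F + Σ² H
      ≡⟨ cong (λ s → Σ² F + s) (sym G≡H) ⟩
    Σ² F + Σ² G
      ≡⟨ cong₂ _+_
           (trans (Σ²-classes F) (cong₂ (λ a b → (f₀ + (f₂ + a)) + (f₁ + (f₃ + b)))
             (Central.class-4≡2 F F-central) (Central.class-5≡1 F F-central)))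
           (trans (Σ²-classes G) (cong₂ (λ a b → (g₀ + (g₂ + a)) + (g₁ + (g₃ + b)))
             (Central.class-4≡2 G G-central) (Central.class-5≡1 G G-central))) ⟩
    ((f₀ + (f₂ + f₂)) + (f₁ + (f₃ + f₁))) + ((g₀ + (g₂ + g₂)) + (g₁ + (g₃ + g₁)))
      ≡⟨ cong₂ (λ a b → ((f₀ + (f₂ + f₂)) + (f₁ + (f₃ + f₁))) + ((a + (b + b)) + (g₁ + (g₃ + g₁))))
           (sym (F≡G-even 0)) (sym (F≡G-even 1)) ⟩
    ((f₀ + (f₂ + f₂)) + (f₁ + (f₃ + f₁))) + ((f₀ + (f₂ + f₂)) + (g₁ + (g₃ + g₁)))
      ≡⟨ cong (λ a → ((f₀ + (f₂ + f₂)) + (f₁ + (f₃ + f₁))) + ((f₀ + (f₂ + f₂)) + (g₁ + (a + g₁)))) (sym F≡G-3) ⟩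
    ((f₀ + (f₂ + f₂)) + (f₁ + (f₃ + f₁))) + ((f₀ + (f₂ + f₂)) + (g₁ + (f₃ + g₁)))
      ≡⟨ collect f₀ f₁ f₂ f₃ g₁ ⟩
    2 * ((f₁ + g₁) + (f₀ + f₃ + (f₂ + f₂)))
      ≡⟨ cong (λ s → 2 * (s + excess)) (sym N≡F+G) ⟩
    2 * (Σ² N + excess) ∎
    where
    open ≡-Reasoning
    f₀ = Σ² (class 0 0 F)
    f₁ = Σ² (class 1 0 F)
    f₂ = Σ² (class 0 1 F)
    f₃ = Σ² (class 1 1 F)
    g₀ = Σ² (class 0 0 G)
    g₁ = Σ² (class 1 0 G)
    g₂ = Σ² (class 0 1 G)
    g₃ = Σ² (class 1 1 G)
    collect : ∀ f₀ f₁ f₂ f₃ g₁ → ((f₀ + (f₂ + f₂)) + (f₁ + (f₃ + f₁))) + ((f₀ + (f₂ + f₂)) + (g₁ + (f₃ + g₁)))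
      ≡ 2 * ((f₁ + g₁) + (f₀ + f₃ + (f₂ + f₂)))
    collect = solve-∀

  module _ (zero₀ : wt Φ (+ 0) ≡ 0) where

    par-excess : par excess ≡ false
    par-excess = trans (par-+ (f₀ + f₃) _) (cong₂ _xor_
      (trans (par-+ f₀ f₃) (cong₂ _xor_ (Central.class-0 F F-central zero₀) (Central.class-3 F F-central)))
      (par-double (Σ² (class 0 1 F))))
      where
      f₀ = Σ² (class 0 0 F)
      f₃ = Σ² (class 1 1 F)

    par-F : par (Σ² F) ≡ false
    par-F = par-Σ²-central F F-central zero₀

-- The Hecke operator at 2

module _ (Φ : Weight) (odd₀ : ∀ z → wt Φ (+ 2 ℤ.* z ℤ.+ + 1) ≡ 0) where

  private
    F F₂ F₄ H H₂ H₄ : Fin²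
    F  = Φ ⟪ 𝔣 ⟫
    F₂ = dilate 2 Φ ⟪ 𝔣 ⟫
    F₄ = dilate 4 Φ ⟪ 𝔣 ⟫
    H  = Φ ⟪ 𝔥 ⟫
    H₂ = dilate 2 Φ ⟪ 𝔥 ⟫
    H₄ = dilate 4 Φ ⟪ 𝔥 ⟫

  -- f(v, y) = 2m forces v or v - y to be even; conjugation v ↦ y - v exchanges
  -- the two cases, and f(2w, y) = 2h(w, y).
  hecke-F : Σ² F + Σ² F₄ ≡ Σ² H₂ + Σ² H₂
  hecke-F = begin
    Σ² F + Σ² F₄               ≡⟨ cong (_+ Σ² F₄) split ⟩
    Σ² H₂ + Σ² O + Σ² F₄       ≡⟨ +-assoc (Σ² H₂) _ _ ⟩
    Σ² H₂ + (Σ² O + Σ² F₄)     ≡⟨ cong (λ s → Σ² H₂ + s) (trans (+-comm (Σ² O) _) (sym split′)) ⟩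
    Σ² H₂ + Σ² H₂              ∎
    where
    open ≡-Reasoning
    E₀ = affine 1 0 F
    E₁ = affine 1 1 F
    E₀₀ = affine 1 0 (swap E₀)
    E₀₁ = affine 1 1 (swap E₀)
    E₁₀ = affine 1 0 (swap E₁)
    O   = affine 1 1 (swap E₁)
    E₀≡H₂ : Σ² E₀ ≡ Σ² H₂
    E₀≡H₂ = Σ²-cong E₀ H₂ (λ v y → cong (wt Φ)
      (solve 2 (λ v y → fₚ (κ 2 :* v :+ κ 0) y := κ 2 :* hₚ v y) refl v y))
    E₁₀≡0 : Σ² E₁₀ ≡ 0
    E₁₀≡0 = Σ²-zero E₁₀ (λ z v → trans (cong (wt Φ)
      (solve 2 (λ z v → fₚ (κ 2 :* v :+ κ 1) (κ 2 :* z :+ κ 0) :=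
        κ 2 :* (κ 2 :* (v :* v) :+ κ 2 :* v :- (κ 2 :* v :+ κ 1) :* z :+ κ 12 :* (z :* z)) :+ κ 1) refl z v))
      (odd₀ (+ 2 ℤ.* (v ℤ.* v) ℤ.+ + 2 ℤ.* v ℤ.- (+ 2 ℤ.* v ℤ.+ + 1) ℤ.* z ℤ.+ + 12 ℤ.* (z ℤ.* z))))
    split : Σ² F ≡ Σ² H₂ + Σ² O
    split = trans (Σ²-dissect₂ F) (cong₂ _+_ E₀≡H₂
      (trans (sym (Σ²-swap E₁)) (trans (Σ²-dissect₂ (swap E₁)) (cong (_+ Σ² O) E₁₀≡0))))
    E₀₀≡F₄ : Σ² E₀₀ ≡ Σ² F₄
    E₀₀≡F₄ = trans (Σ²-cong E₀₀ (swap F₄) (λ z v → cong (wt Φ)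
      (solve 2 (λ z v → fₚ (κ 2 :* v :+ κ 0) (κ 2 :* z :+ κ 0) := κ 4 :* fₚ v z) refl z v))) (Σ²-swap F₄)
    -- For y = 2z + 1 conjugation replaces 2v by y - 2v = 2(z - v) + 1, which is a shear followed by
    -- a sign change.
    E₀₁≡O : Σ² E₀₁ ≡ Σ² O
    E₀₁≡O = trans (Σ²-cong E₀₁ (shear ℤ.-_ (negate O)) (λ z v → cong (wt Φ)
      (solve 2 (λ z v → let y = κ 2 :* z :+ κ 1 in
        fₚ (κ 2 :* v :+ κ 0) y := fₚ (κ 2 :* (:- (v :+ (:- z))) :+ κ 1) y) refl z v)))
      (trans (Σ²-shear ℤ.-_ (negate O)) (Σ²-negate O))
    split′ : Σ² H₂ ≡ Σ² F₄ + Σ² O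
    split′ = trans (sym E₀≡H₂) (trans (sym (Σ²-swap E₀)) (trans (Σ²-dissect₂ (swap E₀)) (cong₂ _+_ E₀₀≡F₄ E₀₁≡O)))

  -- h(w, y) = 2m forces y or w - y to be even, and h(w, 2z) = 2f(w, z),
  -- h(a + b, a - b) = 2h(a, b).
  hecke-H : Σ² H + Σ² H₄ ≡ Σ² F₂ + Σ² H₂
  hecke-H = begin
    Σ² H + Σ² H₄               ≡⟨ cong (_+ Σ² H₄) split ⟩
    Σ² F₂ + Σ² O + Σ² H₄       ≡⟨ +-assoc (Σ² F₂) _ _ ⟩
    Σ² F₂ + (Σ² O + Σ² H₄)     ≡⟨ cong (λ s → Σ² F₂ + s) (trans (+-comm (Σ² O) _) (sym split′)) ⟩
    Σ² F₂ + Σ² H₂              ∎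
    where
    open ≡-Reasoning
    E₀ = affine 1 0 (swap H)
    E₁ = affine 1 1 (swap H)
    E₁₀ = affine 1 0 (swap E₁)
    O   = affine 1 1 (swap E₁)
    E₀≡F₂ : Σ² E₀ ≡ Σ² F₂
    E₀≡F₂ = trans (Σ²-cong E₀ (swap F₂) (λ z w → cong (wt Φ)
      (solve 2 (λ z w → hₚ w (κ 2 :* z :+ κ 0) := κ 2 :* fₚ w z) refl z w))) (Σ²-swap F₂)
    E₁₀≡0 : Σ² E₁₀ ≡ 0
    E₁₀≡0 = Σ²-zero E₁₀ (λ s z → trans (cong (wt Φ)
      (solve 2 (λ s z → hₚ (κ 2 :* s :+ κ 0) (κ 2 :* z :+ κ 1) :=
        κ 2 :* (κ 4 :* (s :* s) :- s :* (κ 2 :* z :+ κ 1) :+ κ 6 :* (z :* z) :+ κ 6 :* z :+ κ 1) :+ κ 1) refl s z))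
      (odd₀ (+ 4 ℤ.* (s ℤ.* s) ℤ.- s ℤ.* (+ 2 ℤ.* z ℤ.+ + 1) ℤ.+ + 6 ℤ.* (z ℤ.* z) ℤ.+ + 6 ℤ.* z ℤ.+ + 1)))
    split : Σ² H ≡ Σ² F₂ + Σ² O
    split = trans (sym (Σ²-swap H)) (trans (Σ²-dissect₂ (swap H)) (cong₂ _+_ E₀≡F₂
      (trans (sym (Σ²-swap E₁)) (trans (Σ²-dissect₂ (swap E₁)) (cong (_+ Σ² O) E₁₀≡0)))))
    -- The first variable of `D` is the difference w - y, so that dissecting it splits by the parity
    -- of w - y.
    D = swap (shear (λ s → s) (swap H₂))
    D₀ = affine 1 0 D
    D₁ = affine 1 1 D
    D₀≡H₄ : Σ² D₀ ≡ Σ² H₄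
    D₀≡H₄ = trans (sym (Σ²-shear ℤ.-_ D₀)) (trans (Σ²-cong (shear ℤ.-_ D₀) (swap H₄) (λ z s → cong (wt Φ)
      (solve 2 (λ z s → let t = s :+ (:- z) in
        κ 2 :* hₚ (κ 2 :* z :+ κ 0 :+ t) t := κ 4 :* hₚ s z) refl z s))) (Σ²-swap H₄))
    -- The identity h(a + b, a - b) = 2h(a, b) again, now at the half-integers a = s + 1/2 and b = z
    -- + 1/2.
    D₁≡O : Σ² D₁ ≡ Σ² O
    D₁≡O = trans (sym (Σ²-shear ℤ.-_ D₁)) (trans (Σ²-cong (shear ℤ.-_ D₁) (swap O) (λ z s → cong (wt Φ)
      (solve 2 (λ z s → let t = s :+ (:- z) in
        κ 2 :* hₚ (κ 2 :* z :+ κ 1 :+ t) t := hₚ (κ 2 :* s :+ κ 1) (κ 2 :* z :+ κ 1)) refl z s))) (Σ²-swap O))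
    split′ : Σ² H₂ ≡ Σ² H₄ + Σ² O
    split′ = trans (sym (trans (Σ²-swap (shear (λ s → s) (swap H₂)))
      (trans (Σ²-shear (λ s → s) (swap H₂)) (Σ²-swap H₂))))
      (trans (Σ²-dissect₂ D) (cong₂ _+_ D₀≡H₄ D₁≡O))

  -- Adding `F+H≡2N+2e` for the three weights and inserting both Hecke relations gives 2F₂ + 4H₂ on
  -- the right. After halving, F₂ + 2H₂ is even because F₂ is, by central symmetry, and the three
  -- excesses are even as well.
  hecke-ν : wt Φ (+ 0) ≡ 0 →
    par (Σ² (Φ ⟪ ν ⟫)) ≡ par (Σ² (dilate 2 Φ ⟪ ν ⟫)) xor par (Σ² (dilate 4 Φ ⟪ ν ⟫))
  hecke-ν zero₀ = xor-solve (par N₁) (par N₂) (par N₄) (begin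
    (par N₁ xor par N₂) xor par N₄
      ≡⟨ sym (xor₃ N₁ N₂ N₄) ⟩
    par (N₁ + N₂ + N₄)
      ≡⟨ sym (trans (par-+ (N₁ + N₂ + N₄) (e₁ + e₂ + e₄)) (trans (cong (par (N₁ + N₂ + N₄) xor_)
           (trans (xor₃ e₁ e₂ e₄) (cong₂ _xor_ (cong₂ _xor_ (par-excess Φ zero₀) (par-excess (dilate 2 Φ) zero₀))
             (par-excess (dilate 4 Φ) zero₀)))) (xor-identityʳ _))) ⟩
    par (N₁ + N₂ + N₄ + (e₁ + e₂ + e₄))
      ≡⟨ cong par (*-cancelˡ-≡ (N₁ + N₂ + N₄ + (e₁ + e₂ + e₄)) (Σ² F₂ + (Σ² H₂ + Σ² H₂)) 2 total) ⟩
    par (Σ² F₂ + (Σ² H₂ + Σ² H₂))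
      ≡⟨ trans (par-+ (Σ² F₂) _) (cong₂ _xor_ (par-F (dilate 2 Φ) zero₀) (par-double (Σ² H₂))) ⟩
    false ∎)
    where
    open ≡-Reasoning
    N₁ = Σ² (Φ ⟪ ν ⟫)
    N₂ = Σ² (dilate 2 Φ ⟪ ν ⟫)
    N₄ = Σ² (dilate 4 Φ ⟪ ν ⟫)
    e₁ = excess Φ
    e₂ = excess (dilate 2 Φ)
    e₄ = excess (dilate 4 Φ)
    xor₃ : ∀ a b c → par (a + b + c) ≡ (par a xor par b) xor par c
    xor₃ a b c = trans (par-+ (a + b) c) (cong (_xor par c) (par-+ a b))
    xor-solve : ∀ a b c → (a xor b) xor c ≡ false → a ≡ b xor c
    xor-solve false false false _ = refl
    xor-solve false true  true  _ = refl
    xor-solve true  false true  _ = refl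
    xor-solve true  true  false _ = refl
    regroup : ∀ a b c x y z → 2 * (a + b + c + (x + y + z)) ≡ 2 * (a + x) + 2 * (b + y) + 2 * (c + z)
    regroup = solve-∀
    pair : ∀ a b c x y z → (a + x) + (b + y) + (c + z) ≡ ((a + c) + (x + z)) + (b + y)
    pair = solve-∀
    double : ∀ b y → ((y + y) + (b + y)) + (b + y) ≡ 2 * (b + (y + y))
    double = solve-∀
    total : 2 * (N₁ + N₂ + N₄ + (e₁ + e₂ + e₄)) ≡ 2 * (Σ² F₂ + (Σ² H₂ + Σ² H₂))
    total = begin
      2 * (N₁ + N₂ + N₄ + (e₁ + e₂ + e₄))
        ≡⟨ regroup N₁ N₂ N₄ e₁ e₂ e₄ ⟩
      2 * (N₁ + e₁) + 2 * (N₂ + e₂) + 2 * (N₄ + e₄)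
        ≡⟨ sym (cong₂ _+_ (cong₂ _+_ (F+H≡2N+2e Φ) (F+H≡2N+2e (dilate 2 Φ))) (F+H≡2N+2e (dilate 4 Φ))) ⟩
      (Σ² F + Σ² H) + (Σ² F₂ + Σ² H₂) + (Σ² F₄ + Σ² H₄)
        ≡⟨ pair (Σ² F) (Σ² F₂) (Σ² F₄) (Σ² H) (Σ² H₂) (Σ² H₄) ⟩
      ((Σ² F + Σ² F₄) + (Σ² H + Σ² H₄)) + (Σ² F₂ + Σ² H₂)
        ≡⟨ cong (_+ (Σ² F₂ + Σ² H₂)) (cong₂ _+_ hecke-F hecke-H) ⟩
      ((Σ² H₂ + Σ² H₂) + (Σ² F₂ + Σ² H₂)) + (Σ² F₂ + Σ² H₂)
        ≡⟨ double (Σ² F₂) (Σ² H₂) ⟩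
      2 * (Σ² F₂ + (Σ² H₂ + Σ² H₂)) ∎

-- The odd part of the generating function modulo 2

δ : ∀ {P : Set} → Dec P → ℕ
δ (yes _) = 1
δ (no  _) = 0

δ-⇔ : ∀ {P Q : Set} (P? : Dec P) (Q? : Dec Q) → (P → Q) → (Q → P) → δ P? ≡ δ Q?
δ-⇔ (yes _) (yes _) _   _   = refl
δ-⇔ (yes p) (no ¬q) P⇒Q _   = contradiction (P⇒Q p) ¬q
δ-⇔ (no ¬p) (yes q) _   Q⇒P = contradiction (Q⇒P q) ¬p
δ-⇔ (no _)  (no _)  _   _   = refl

δ-no : ∀ {P : Set} (P? : Dec P) → ¬ P → δ P? ≡ 0
δ-no (yes p) ¬p = contradiction p ¬p
δ-no (no _)  _  = refl

ind : ℕ → Weight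
ind m = record
  { wt   = λ z → δ (z ℤ.≟ + m)
  ; cut  = suc m
  ; supp = λ z m<z → δ-no (z ℤ.≟ + m) (λ z≡m → <-irrefl refl (subst (m <_) (cong ∣_∣ z≡m) m<z)) }

repParity : ℕ → Bool
repParity m = par (Σ² (ind m ⟪ ν ⟫))

repParity-vanishes : ∀ m → (∀ k j → νᵥ k j ≢ + m) → repParity m ≡ false
repParity-vanishes m none = cong par (Σ²-zero (ind m ⟪ ν ⟫) (λ k j → δ-no (νᵥ k j ℤ.≟ + m) (none k j)))

parity : ∀ n → ∃ (λ l → n ≡ 2 * l) ⊎ ∃ (λ l → n ≡ suc (2 * l))
parity zero = inj₁ (0 , refl)
parity (suc n) with parity n
... | inj₁ (l , refl) = inj₂ (l , refl)
... | inj₂ (l , refl) = inj₁ (suc l , sym (*-suc 2 l))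

odd≢even : ∀ z w → + 2 ℤ.* z ℤ.+ + 1 ≢ + 2 ℤ.* w
odd≢even z w eq = contradiction (trans (cong ∣_∣ one≡) (ℤ.abs-* (+ 2) (w ℤ.- z))) (2*≢1 ∣ w ℤ.- z ∣)
  where
  cancel : ∀ z → + 1 ≡ + 2 ℤ.* z ℤ.+ + 1 ℤ.- + 2 ℤ.* z
  cancel = ℤR.solve-∀
  factor : ∀ w z → + 2 ℤ.* w ℤ.- + 2 ℤ.* z ≡ + 2 ℤ.* (w ℤ.- z)
  factor = ℤR.solve-∀
  one≡ : + 1 ≡ + 2 ℤ.* (w ℤ.- z)
  one≡ = trans (cancel z) (trans (cong (λ t → t ℤ.- + 2 ℤ.* z) eq) (factor w z))
  2*≢1 : ∀ n → 1 ≢ 2 * n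
  2*≢1 zero ()
  2*≢1 (suc n) eq′ = contradiction (trans eq′ (*-suc 2 n)) λ ()

-- The substitution of q² for q.
up : Series₂ → Series₂
up f zero          = f 0
up f (suc zero)    = false
up f (suc (suc n)) = up (f ∘ suc) n

up-even : ∀ f l → up f (2 * l) ≡ f l
up-even f zero    = refl
up-even f (suc l) = trans (cong (up f) (*-suc 2 l)) (up-even (f ∘ suc) l)

up-odd : ∀ f l → up f (suc (2 * l)) ≡ false
up-odd f zero    = refl
up-odd f (suc l) = trans (cong (up f ∘ suc) (*-suc 2 l)) (up-odd (f ∘ suc) l)

-- This is F/q = f₁f₂₃, hence the index `suc d`.
θ : Series₂
θ d = repParity (suc d)

-- The Hecke relation a(2m) = a(m) + a(m/2) for q(q;q)_∞(q²³;q²³)_∞ = ∑ a(m) q^m modulo 2.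
hecke-θ : ∀ n → θ (suc (2 * n)) ≡ (θ ⊕ sh 1 (up θ)) n
hecke-θ n = trans (cong repParity (sym (*-suc 2 n))) (trans (hecke-ν Φ odd₀ (δ-no (+ 0 ℤ.≟ + (2 * suc n)) λ ()))
  (cong₂ _xor_ (cong par halve) (quarter n (parity n))))
  where
  Φ = ind (2 * suc n)
  cast : ∀ m → + (2 * m) ≡ + 2 ℤ.* + m
  cast m = ℤ.pos-* 2 m
  odd₀ : ∀ z → wt Φ (+ 2 ℤ.* z ℤ.+ + 1) ≡ 0
  odd₀ z = δ-no (+ 2 ℤ.* z ℤ.+ + 1 ℤ.≟ + (2 * suc n)) (λ eq → odd≢even z (+ suc n) (trans eq (cast (suc n))))
  halve : Σ² (dilate 2 Φ ⟪ ν ⟫) ≡ Σ² (ind (suc n) ⟪ ν ⟫)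
  halve = Σ²-cong (dilate 2 Φ ⟪ ν ⟫) (ind (suc n) ⟪ ν ⟫) (λ k j → let z = νᵥ k j in
    δ-⇔ (+ 2 ℤ.* z ℤ.≟ + (2 * suc n)) (z ℤ.≟ + suc n)
      (λ eq → ℤ.*-cancelˡ-≡ (+ 2) z (+ suc n) (trans eq (cast (suc n))))
      (λ eq → trans (cong (+ 2 ℤ.*_) eq) (sym (cast (suc n)))))
  four : ∀ z → + 4 ℤ.* z ≡ + 2 ℤ.* (+ 2 ℤ.* z)
  four z = ℤ.*-assoc (+ 2) (+ 2) z
  -- The term a((n + 1)/2) is nonzero only for n = 2l + 1, where it is the coefficient of q^l in θ,
  -- that is, of q^n in q θ(q²).
  quarter : ∀ n → ∃ (λ l → n ≡ 2 * l) ⊎ ∃ (λ l → n ≡ suc (2 * l)) →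
    par (Σ² (dilate 4 (ind (2 * suc n)) ⟪ ν ⟫)) ≡ sh 1 (up θ) n
  quarter n (inj₁ (l , refl)) = trans
    (cong par (Σ²-zero (dilate 4 (ind (2 * suc n)) ⟪ ν ⟫) (λ k j → let z = νᵥ k j in
      δ-no (+ 4 ℤ.* z ℤ.≟ + (2 * suc n)) (λ eq → odd≢even (+ l) z (sym (trans
        (ℤ.*-cancelˡ-≡ (+ 2) (+ 2 ℤ.* z) (+ suc n) (trans (sym (four z)) (trans eq (cast (suc n)))))
        (trans (cong +_ (+-comm 1 n)) (cong (λ t → t ℤ.+ + 1) (cast l)))))))))
    (sym (shift l))
    where
    shift : ∀ l → sh 1 (up θ) (2 * l) ≡ false
    shift zero    = refl
    shift (suc l) = trans (cong (sh 1 (up θ)) (*-suc 2 l)) (up-odd θ l)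
  quarter n (inj₂ (l , refl)) = trans (cong par (Σ²-cong (dilate 4 (ind (2 * suc n)) ⟪ ν ⟫) (ind (suc l) ⟪ ν ⟫)
    (λ k j → let z = νᵥ k j in δ-⇔ (+ 4 ℤ.* z ℤ.≟ + (2 * suc n)) (z ℤ.≟ + suc l)
      (λ eq → ℤ.*-cancelˡ-≡ (+ 4) z (+ suc l) (trans eq cast₄))
      (λ eq → trans (cong (+ 4 ℤ.*_) eq) (sym cast₄))))) (sym (up-even θ l))
    where
    cast₄ : + (2 * suc (suc (2 * l))) ≡ + 4 ℤ.* + suc l
    cast₄ = trans (cong +_ (arith l)) (ℤ.pos-* 4 (suc l))
      where
      arith : ∀ l → 2 * suc (suc (2 * l)) ≡ 4 * suc l
      arith = solve-∀

-- The products as series, and extraction of the odd part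

e₁ e₂₃ : ℕ → ℕ
e₁ j  = 1 * suc j
e₂₃ j = 23 * suc j

sh-one : ∀ e d → sh e one d ≡ par (δ (+ suc e ℤ.≟ + suc d))
sh-one e d with + suc e ℤ.≟ + suc d
sh-one e .e | yes refl = diag e
  where
  diag : ∀ e → sh e one e ≡ true
  diag zero    = refl
  diag (suc e) = diag e
... | no ne = off e d (λ eq → ne (cong (λ n → + suc n) eq))
  where
  off : ∀ e d → e ≢ d → sh e one d ≡ false
  off zero    zero    ne = contradiction refl ne
  off zero    (suc d) ne = refl
  off (suc e) zero    ne = refl
  off (suc e) (suc d) ne = off e d (ne ∘ cong suc)

-- There is one factor more than the degree, so that the cutoff M + 2 of the pentagonal sum covers
-- the support bound d + 2 of the count.
product≡θ : ∀ M → prodE e₁ (suc M) (prodE e₂₃ (suc M) one) ≈[ M ] θ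
product≡θ M d d≤M = begin
  prodE e₁ (suc M) (prodE e₂₃ (suc M) one) d
    ≡⟨ pentagonal₂ (suc M) d (m≤n⇒m≤1+n d≤M) ⟩
  sumℤ₂ K (λ k → sumℤ₂ K (λ j → sh (ω k + 23 * ω j) one d))
    ≡⟨ sumℤ₂-cong K (λ k → trans (sumℤ₂-cong K (λ j → sh-one (ω k + 23 * ω j) d)) (sym (par-sumℤ K (fun W k)))) ⟩
  sumℤ₂ K (λ k → par (sumℤ K (fun W k)))
    ≡⟨ sym (par-sumℤ K (λ k → sumℤ K (fun W k))) ⟩
  par (sumℤ K (λ k → sumℤ K (fun W k)))
    ≡⟨ cong par (Σ²-at W (≤-trans (≤-reflexive (*-identityˡ (2 + d))) (s≤s (s≤s d≤M)))) ⟩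
  θ d ∎
  where
  open ≡-Reasoning
  K = suc (suc M)
  W = ind (suc d) ⟪ ν ⟫

oddPart : Series₂ → Series₂
oddPart f n = f (suc (2 * n))

-- An even power of q preserves the parity of exponents, so series in q² can be pulled out of the
-- odd part.
oddPart-sh : ∀ m f → oddPart (sh (m + m) f) ≗ sh m (oddPart f)
oddPart-sh zero    f n = refl
oddPart-sh (suc m) f zero = cong (λ e → sh e f 0) (+-suc m m)
oddPart-sh (suc m) f (suc n) = trans (cong₂ (λ e i → sh e f i) (+-suc m m) (*-suc 2 n)) (oddPart-sh m f n)

oddPart-prodE : ∀ e J f → oddPart (prodE (λ j → e j + e j) J f) ≗ prodE e J (oddPart f)
oddPart-prodE e zero    f n = refl
oddPart-prodE e (suc J) f n = trans
  (cong (prodE (λ j → e j + e j) J f (suc (2 * n)) xor_) (oddPart-sh (e J) (prodE (λ j → e j + e j) J f) n))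
  (E-congˢ (e J) (oddPart-prodE e J f) n)

up-cong : ∀ {f g} N → f ≈[ N ] g → up f ≈[ N ] up g
up-cong N eq zero          le = eq 0 z≤n
up-cong N eq (suc zero)    le = refl
up-cong (suc N) eq (suc (suc n)) (s≤s le) = up-cong N (λ i i≤N → eq (suc i) (s≤s i≤N)) n (<⇒≤ le)

up-⊕ : ∀ f g → up (f ⊕ g) ≗ up f ⊕ up g
up-⊕ f g zero          = refl
up-⊕ f g (suc zero)    = refl
up-⊕ f g (suc (suc n)) = up-⊕ (f ∘ suc) (g ∘ suc) n

up-sh : ∀ m f → up (sh m f) ≗ sh (m + m) (up f)
up-sh zero    f n = refl
up-sh (suc m) f zero = refl
up-sh (suc m) f (suc zero) = cong (λ e → sh e (up f) 0) (sym (+-suc m m))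
up-sh (suc m) f (suc (suc n)) = trans (up-sh m f n) (cong (λ e → sh e (up f) (suc n)) (sym (+-suc m m)))

up-one : up one ≗ one
up-one zero          = refl
up-one (suc zero)    = refl
up-one (suc (suc n)) = zeros n
  where
  zeros : ∀ n → up (λ _ → false) n ≡ false
  zeros zero          = refl
  zeros (suc zero)    = refl
  zeros (suc (suc n)) = zeros n

up-prodE : ∀ e J f → up (prodE e J f) ≗ prodE e J (prodE e J (up f))
up-prodE e J f n = trans (doubled J n) (prodE-square e J (up f) n)
  where
  doubled : ∀ J → up (prodE e J f) ≗ prodE (λ j → e j + e j) J (up f)
  doubled zero    n = refl
  doubled (suc J) n = trans (up-⊕ (prodE e J f) (sh (e J) (prodE e J f)) n)
    (trans (cong (up (prodE e J f) n xor_) (up-sh (e J) (prodE e J f) n)) (E-congˢ (e J + e J) (doubled J) n))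

-- Modulo 2 the square of ∏ (1 - q^(cj)) is ∏ (1 - q^(2cj)), so the odd part of
-- the product over odd indices, multiplied by the full product, is the odd
-- part of the full product, to which the Hecke relation applies.
module OddPart (M : ℕ) where

  N = suc M

  P P′ : Series₂ → Series₂
  P  = prodE e₁ N
  P′ = prodE e₂₃ N

  -- Since `e₁ j` is j + 1, even indices give the odd exponents: this is the generating function of
  -- A₂₃ modulo 2.
  A₂ : Series₂
  A₂ = prodE (λ j → e₁ (2 * j)) N (prodE (λ j → e₂₃ (2 * j)) N one)

  B : Series₂
  B = P (P′ one)

  PP′ : ∀ f → P (P′ f) ≗ P′ (P f)
  PP′ = prodE-prodE e₁ e₂₃ N N

  upB : up B ≗ P (P′ B)
  upB n = begin
    up B n                      ≡⟨ up-prodE e₁ N (P′ one) n ⟩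
    P (P (up (P′ one))) n       ≡⟨ congPP (λ i → trans (up-prodE e₂₃ N one i) (prodE-congˢ e₂₃ N (prodE-congˢ e₂₃ N up-one) i)) n ⟩
    P (P (P′ (P′ one))) n       ≡⟨ prodE-congˢ e₁ N (PP′ (P′ one)) n ⟩
    P (P′ B) n                  ∎
    where
    open ≡-Reasoning
    congPP : ∀ {f g} → f ≗ g → P (P f) ≗ P (P g)
    congPP eq = prodE-congˢ e₁ N (prodE-congˢ e₁ N eq)

  evenFactors : ∀ c j → c * suc (suc (2 * j)) ≡ c * suc j + c * suc j
  evenFactors = solve-∀

  D D′ : Series₂ → Series₂
  D  = prodE (λ j → e₁ j + e₁ j) N
  D′ = prodE (λ j → e₂₃ j + e₂₃ j) N

  -- The doubled exponents c(2j + 2) are exactly the factors that `A₂` omits.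
  full : D (D′ A₂) ≗ prodE e₁ (2 * N) (prodE e₂₃ (2 * N) one)
  full n = begin
    D (D′ A₂) n
      ≡⟨ prodE-congˢ _ N (prodE-prodE _ (λ j → e₁ (2 * j)) N N (prodE (λ j → e₂₃ (2 * j)) N one)) n ⟩
    D (prodE (λ j → e₁ (2 * j)) N (D′ (prodE (λ j → e₂₃ (2 * j)) N one))) n
      ≡⟨ inter e₁ (λ j → sym (evenFactors 1 j)) _ n ⟩
    prodE e₁ (2 * N) (D′ (prodE (λ j → e₂₃ (2 * j)) N one)) n
      ≡⟨ prodE-congˢ e₁ (2 * N) (inter e₂₃ (λ j → sym (evenFactors 23 j)) one) n ⟩
    prodE e₁ (2 * N) (prodE e₂₃ (2 * N) one) n ∎
    where
    open ≡-Reasoning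
    inter : ∀ e → (λ j → e j + e j) ≗ (λ j → e (suc (2 * j))) → ∀ f →
      prodE (λ j → e j + e j) N (prodE (λ j → e (2 * j)) N f) ≗ prodE e (2 * N) f
    inter e eq f n = trans (prodE-ext eq N _ n) (prodE-interleave e N f n)

  -- The Hecke relation gives θ + q θ(q²), and θ(q²) ≡ θ² modulo 2, so the whole is θ(1 + qθ) and
  -- the factor θ can be cancelled.
  odd-full : P (P′ (oddPart A₂)) ≈[ M ] P (P′ (one ⊕ sh 1 B))
  odd-full n n≤M = begin
    P (P′ (oddPart A₂)) n
      ≡⟨ sym (trans (oddPart-prodE e₁ N (D′ A₂) n) (prodE-congˢ e₁ N (oddPart-prodE e₂₃ N A₂) n)) ⟩
    oddPart (D (D′ A₂)) n
      ≡⟨ full (suc (2 * n)) ⟩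
    -- With N = M + 1 the 2N factors are exactly those that `product≡θ` requires up to degree 2M +
    -- 1.
    prodE e₁ (2 * N) (prodE e₂₃ (2 * N) one) (suc (2 * n))
      ≡⟨ cong (λ K → prodE e₁ K (prodE e₂₃ K one) (suc (2 * n))) (*-suc 2 M) ⟩
    prodE e₁ (2 + 2 * M) (prodE e₂₃ (2 + 2 * M) one) (suc (2 * n))
      ≡⟨ product≡θ (suc (2 * M)) (suc (2 * n)) (s≤s (*-monoʳ-≤ 2 n≤M)) ⟩
    θ (suc (2 * n))
      ≡⟨ hecke-θ n ⟩
    θ n xor sh 1 (up θ) n
      ≡⟨ sym (cong₂ _xor_ (product≡θ M n n≤M) (sh-cong 1 (up-cong M (product≡θ M)) n n≤M)) ⟩
    B n xor sh 1 (up B) n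
      ≡⟨ cong (B n xor_) (sh-congˢ 1 upB n) ⟩
    B n xor sh 1 (P (P′ B)) n
      ≡⟨ cong (B n xor_) (sym (trans (prodE-congˢ e₁ N (prodE-sh e₂₃ N 1 B) n) (prodE-sh e₁ N 1 (P′ B) n))) ⟩
    B n xor P (P′ (sh 1 B)) n
      ≡⟨ sym (trans (prodE-congˢ e₁ N (prodE-⊕ e₂₃ N one (sh 1 B)) n) (prodE-⊕ e₁ N (P′ one) (P′ (sh 1 B)) n)) ⟩
    P (P′ (one ⊕ sh 1 B)) n ∎
    where open ≡-Reasoning

  oddPart≈ : oddPart A₂ ≈[ M ] one ⊕ sh 1 B
  oddPart≈ = prodE-injective e₂₃ (λ _ → s≤s z≤n) N M (prodE-injective e₁ (λ _ → s≤s z≤n) N M odd-full)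

  -- The index `suc n` avoids the constant term `one`, which would spoil the formula at m = 0.
  coefficient : ∀ n → suc n ≤ M → A₂ (suc (2 * suc n)) ≡ repParity (suc n)
  coefficient n n<M = trans (oddPart≈ (suc n) n<M) (product≡θ M n (<⇒≤ n<M))

-- From truncated integer series to series modulo 2

bit : ℤ → Bool
bit z = par ∣ z ∣

bit-⊖ : ∀ m n → bit (m ⊖ n) ≡ par m xor par n
bit-⊖ m       zero    = sym (xor-identityʳ (par m))
bit-⊖ zero    (suc n) = refl
bit-⊖ (suc m) (suc n) = trans (cong bit (ℤ.[1+m]⊖[1+n]≡m⊖n m n)) (trans (bit-⊖ m n) (nots (par m) (par n)))
  where
  nots : ∀ a b → a xor b ≡ not a xor not b
  nots false b = sym (not-involutive b)
  nots true  b = refl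

bit-+ : ∀ a b → bit (a ℤ.+ b) ≡ bit a xor bit b
bit-+ (+ m)      (+ n)      = par-+ m n
bit-+ (+ m)      (-[1+ n ]) = bit-⊖ m (suc n)
bit-+ (-[1+ m ]) (+ n)      = trans (bit-⊖ n (suc m)) (xor-comm (par n) (par (suc m)))
bit-+ (-[1+ m ]) (-[1+ n ]) = trans (cong par (cong suc (sym (+-suc m n)))) (par-+ (suc m) (suc n))

bit-- : ∀ a b → bit (a ℤ.- b) ≡ bit a xor bit b
bit-- a b = trans (bit-+ a (ℤ.- b)) (cong (λ n → bit a xor par n) (ℤ.∣-i∣≡∣i∣ b))

par⇒2∣ : ∀ n → par n ≡ false → 2 ℕ.∣ n
par⇒2∣ zero          _  = ℕ.divides 0 refl
par⇒2∣ (suc zero)    ()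
par⇒2∣ (suc (suc n)) eq = ℕ.∣m∣n⇒∣m+n (ℕ.divides 1 refl) (par⇒2∣ n (trans (sym (not-involutive (par n))) eq))

bits : Series → Series₂
bits s i = bit (coeff i s)

coeff-suc : ∀ i x xs → coeff (suc i) (x ∷ xs) ≡ coeff i xs
coeff-suc i x xs with drop i xs
... | []    = refl
... | _ ∷ _ = refl

coeff-zipWith : ∀ i xs ys → i < length xs → i < length ys →
  coeff i (zipWith ℤ._-_ xs ys) ≡ coeff i xs ℤ.- coeff i ys
coeff-zipWith zero    (x ∷ xs) (y ∷ ys) _ _ = refl
coeff-zipWith (suc i) (x ∷ xs) (y ∷ ys) (s≤s i<x) (s≤s i<y) =
  trans (coeff-suc i (x ℤ.- y) (zipWith ℤ._-_ xs ys))
    (trans (coeff-zipWith i xs ys i<x i<y) (sym (cong₂ ℤ._-_ (coeff-suc i x xs) (coeff-suc i y ys))))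

bits-shift : ∀ m s → bits (replicate m (+ 0) ++ s) ≗ sh m (bits s)
bits-shift zero    s i       = refl
bits-shift (suc m) s zero    = refl
bits-shift (suc m) s (suc i) = trans (cong bit (coeff-suc i (+ 0) (replicate m (+ 0) ++ s))) (bits-shift m s i)

length-shift : ∀ m (s : Series) → length (replicate m (+ 0) ++ s) ≡ m + length s
length-shift m s = trans (length-++ (replicate m (+ 0))) (cong (_+ length s) (length-replicate m))

length-oneMinus : ∀ m s → length (oneMinus m s) ≡ length s
length-oneMinus m s = trans (length-zipWith ℤ._-_ s (replicate m (+ 0) ++ s))
  (m≤n⇒m⊓n≡m (≤-trans (m≤n+m (length s) m) (≤-reflexive (sym (length-shift m s)))))

bits-oneMinus : ∀ m s i → i < length s → bits (oneMinus m s) i ≡ E m (bits s) i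
bits-oneMinus m s i lt = trans
  (cong bit (coeff-zipWith i s (replicate m (+ 0) ++ s) lt
    (≤-trans lt (≤-trans (m≤n+m (length s) m) (≤-reflexive (sym (length-shift m s)))))))
  (trans (bit-- (coeff i s) _) (cong (bits s i xor_) (bits-shift m s i)))

length-prodOneMinus : ∀ e J s → length (prodOneMinus e J s) ≡ length s
length-prodOneMinus e zero    s = refl
length-prodOneMinus e (suc J) s = trans (length-oneMinus (e J) (prodOneMinus e J s)) (length-prodOneMinus e J s)

bits-prodOneMinus : ∀ e J s n → n < length s → bits (prodOneMinus e J s) ≈[ n ] prodE e J (bits s)
bits-prodOneMinus e zero    s n lt i i≤n = refl
bits-prodOneMinus e (suc J) s n lt i i≤n = trans
  (bits-oneMinus (e J) (prodOneMinus e J s) i (subst (i <_) (sym (length-prodOneMinus e J s)) (≤-<-trans i≤n lt)))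
  (E-cong (e J) (bits-prodOneMinus e J s n lt) i i≤n)

bits-oneUpTo : ∀ n → bits (oneUpTo n) ≗ one
bits-oneUpTo n zero    = refl
bits-oneUpTo n (suc i) = cong bit (trans (coeff-suc i (+ 1) (replicate n (+ 0))) (zeros n i))
  where
  zeros : ∀ n i → coeff i (replicate n (+ 0)) ≡ + 0
  zeros zero    zero    = refl
  zeros zero    (suc i) = refl
  zeros (suc n) zero    = refl
  zeros (suc n) (suc i) = trans (coeff-suc i (+ 0) (replicate n (+ 0))) (zeros n i)

bit-A : ∀ m → bit (A 23 (suc (2 * suc m))) ≡ repParity (suc m)
bit-A m = begin
  bits (prodOneMinus odd (suc n) (prodOneMinus odd₂₃ (suc n) (oneUpTo n))) n
    ≡⟨ bits-prodOneMinus odd (suc n) _ n (subst (n <_) (sym (trans (length-prodOneMinus odd₂₃ (suc n) (oneUpTo n)) len)) ≤-refl) n ≤-refl ⟩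
  prodE odd (suc n) (bits (prodOneMinus odd₂₃ (suc n) (oneUpTo n))) n
    ≡⟨ prodE-cong odd (suc n) (λ i i≤n → trans
         (bits-prodOneMinus odd₂₃ (suc n) (oneUpTo n) n (subst (n <_) (sym len) ≤-refl) i i≤n)
         (prodE-congˢ odd₂₃ (suc n) (bits-oneUpTo n) i)) n ≤-refl ⟩
  prodE odd (suc n) (prodE odd₂₃ (suc n) one) n
    ≡⟨ prodE-ext (λ j → sym (*-identityˡ (suc (2 * j)))) (suc n) _ n ⟩
  OddPart.A₂ n n
    -- The number `suc n` of factors in `A` is `OddPart.N` for M = n, which exceeds the degree m + 1
    -- needed here.
    ≡⟨ OddPart.coefficient n m (≤-trans (m≤n*m (suc m) 2) (n≤1+n _)) ⟩
  repParity (suc m) ∎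
  where
  open ≡-Reasoning
  n = suc (2 * suc m)
  odd odd₂₃ : ℕ → ℕ
  odd j   = suc (2 * j)
  odd₂₃ j = 23 * suc (2 * j)
  len : length (oneUpTo n) ≡ suc n
  len = cong suc (length-replicate n)

-- Integers not represented by u² + 23v²

-- Completing the square: 24 ω(k) + 1 = (6k + 1)², and 24 = 1 + 23 absorbs the `suc` of `νᵥ`.
24*ν : ∀ k j → let u = + 6 ℤ.* k ℤ.+ + 1 ; v = + 6 ℤ.* j ℤ.+ + 1 in
  + 24 ℤ.* νᵥ k j ≡ u ℤ.* u ℤ.+ + 23 ℤ.* (v ℤ.* v)
24*ν k j = trans (ℤ.*-assoc (+ 12) (+ 2) (νᵥ k j)) (trans (cong (+ 12 ℤ.*_) (2*ν k j))
  (solve 2 (λ k j → let u = κ 6 :* k :+ κ 1 ; v = κ 6 :* j :+ κ 1 in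
    κ 12 :* (κ 2 :+ k :* (κ 3 :* k :+ κ 1) :+ κ 23 :* (j :* (κ 3 :* j :+ κ 1))) :=
    u :* u :+ κ 23 :* (v :* v)) refl k j))

-- Signs and the congruences modulo 6 are dropped, so that the condition is stable under the
-- divisions of u and v made in the descent.
NotRepresented : ℕ → Set
NotRepresented n = ∀ u v → u * u + 23 * (v * v) ≢ n

A-even : ∀ m → .{{NonZero m}} → NotRepresented (24 * m) → (+ 2) ∣ A 23 (2 * m + 1)
A-even (suc m) none = par⇒2∣ _ (trans (cong (λ n → bit (A 23 n)) (+-comm (2 * suc m) 1))
  (trans (bit-A m) (repParity-vanishes (suc m) none′)))
  where
  none′ : ∀ k j → νᵥ k j ≢ + suc m
  none′ k j eq = none ∣ u ∣ ∣ v ∣ (ℤ.+-injective (begin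
    + (∣ u ∣ * ∣ u ∣ + 23 * (∣ v ∣ * ∣ v ∣))
      ≡⟨ cong₂ ℤ._+_ (sym (square-abs u)) (trans (ℤ.pos-* 23 (∣ v ∣ * ∣ v ∣)) (cong (+ 23 ℤ.*_) (sym (square-abs v)))) ⟩
    u ℤ.* u ℤ.+ + 23 ℤ.* (v ℤ.* v)
      ≡⟨ sym (24*ν k j) ⟩
    + 24 ℤ.* νᵥ k j
      ≡⟨ cong (+ 24 ℤ.*_) eq ⟩
    + 24 ℤ.* + suc m
      ≡⟨ sym (ℤ.pos-* 24 (suc m)) ⟩
    + (24 * suc m) ∎))
    where
    open ≡-Reasoning
    u = + 6 ℤ.* k ℤ.+ + 1
    v = + 6 ℤ.* j ℤ.+ + 1

∣m+n∣n⇒∣m : ∀ {i m n} → i ℕ.∣ m + n → i ℕ.∣ n → i ℕ.∣ m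
∣m+n∣n⇒∣m {i} {m} {n} i∣m+n = ℕ.∣m+n∣m⇒∣n (subst (i ℕ.∣_) (+-comm m n) i∣m+n)

prime-23 : Prime 23
prime-23 = from-yes (prime? 23)

prime∣square : ∀ {p} → Prime p → ∀ u → p ℕ.∣ u * u → p ℕ.∣ u
prime∣square pp u p∣u² = [ id , id ]′ (euclidsLemma u u pp p∣u²)

-- u = 23q turns u² + 23v² = 23n into v² + 23q² = n.
descend-23 : ∀ n → NotRepresented n → NotRepresented (23 * n)
descend-23 n none u v eq = absurd (prime∣square prime-23 u
  (∣m+n∣n⇒∣m (subst (23 ℕ.∣_) (sym eq) (ℕ.m∣m*n n)) (ℕ.m∣m*n (v * v))))
  where
  expand : ∀ q v → 23 * (v * v + 23 * (q * q)) ≡ q * 23 * (q * 23) + 23 * (v * v)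
  expand = solve-∀
  absurd : ¬ 23 ℕ.∣ u
  absurd (ℕ.divides q refl) = none v q (*-cancelˡ-≡ (v * v + 23 * (q * q)) n 23 (trans (expand q v) eq))

descend-23^ : ∀ α M → NotRepresented (24 * M) → NotRepresented (24 * (23 ^ α * M))
descend-23^ zero    M none = subst (λ n → NotRepresented (24 * n)) (sym (*-identityˡ M)) none
descend-23^ (suc α) M none = subst NotRepresented (move (23 ^ α) M)
  (descend-23 (24 * (23 ^ α * M)) (descend-23^ α M none))
  where
  move : ∀ X M → 23 * (24 * (X * M)) ≡ 24 * (23 * X * M)
  move = solve-∀

-- As 24 ≡ 1 (mod 23), this says that r + 1 is a nonresidue; the list below consists of the eleven
-- nonresidues, each less one.
NonSquare₂₃ : ℕ → Set
NonSquare₂₃ r = ∀ (a : Fin 23) → toℕ a * toℕ a % 23 ≢ 24 * (r + 1) % 23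

residues : List ℕ
residues = 4 ∷ 6 ∷ 9 ∷ 10 ∷ 13 ∷ 14 ∷ 16 ∷ 18 ∷ 19 ∷ 20 ∷ 21 ∷ []

residues-nonSquare : All NonSquare₂₃ residues
residues-nonSquare = from-yes (All.all? nonSquare₂₃? residues)
  where
  nonSquare₂₃? : ∀ r → Dec (NonSquare₂₃ r)
  nonSquare₂₃? r = all? (λ a → ¬? (toℕ a * toℕ a % 23 ≟ 24 * (r + 1) % 23))

nonSquare⇒notRepresented : ∀ n r → NonSquare₂₃ r → NotRepresented (24 * (23 * n + r + 1))
nonSquare⇒notRepresented n r ns u v eq = ns (fromℕ< (m%n<n u 23)) (begin
  toℕ a * toℕ a % 23                 ≡⟨ cong (λ b → b * b % 23) (toℕ-fromℕ< (m%n<n u 23)) ⟩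
  (u % 23) * (u % 23) % 23           ≡⟨ sym (%-distribˡ-* u u 23) ⟩
  u * u % 23                         ≡⟨ sym ([m+kn]%n≡m%n (u * u) (v * v) 23) ⟩
  (u * u + v * v * 23) % 23          ≡⟨ cong (λ x → (u * u + x) % 23) (*-comm (v * v) 23) ⟩
  (u * u + 23 * (v * v)) % 23        ≡⟨ cong (_% 23) (trans eq (split n r)) ⟩
  (24 * (r + 1) + 24 * n * 23) % 23  ≡⟨ [m+kn]%n≡m%n (24 * (r + 1)) (24 * n) 23 ⟩
  24 * (r + 1) % 23                  ∎)
  where
  open ≡-Reasoning
  a = fromℕ< (m%n<n u 23)
  split : ∀ n r → 24 * (23 * n + r + 1) ≡ 24 * (r + 1) + 24 * n * 23
  split = solve-∀

part-i : (n α r : ℕ) → r ∈ residues → (+ 2) ∣ A 23 (2 * 23 ^ α * (23 * n + r) + 2 * 23 ^ α + 1)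
part-i n α r r∈ = subst (λ N → (+ 2) ∣ A 23 N) (index (23 ^ α) (23 * n + r))
  (A-even (23 ^ α * (23 * n + r + 1)) {{m*n≢0 (23 ^ α) (23 * n + r + 1) {{m^n≢0 23 α}} {{>-nonZero (m≤n+m 1 (23 * n + r))}}}}
    (descend-23^ α (23 * n + r + 1) (nonSquare⇒notRepresented n r (All.lookup residues-nonSquare r∈))))
  where
  index : ∀ X y → 2 * (X * (y + 1)) + 1 ≡ 2 * X * y + 2 * X + 1
  index = solve-∀

-- Descent at an inert prime

module Inert {p} (pp : Prime p) (3<p : 3 < p) (legendre : LegendreMinusOne (-[1+ 22 ]) p) where

  instance
    p≢0 : NonZero p
    p≢0 = prime⇒nonZero pp

  nonresidue : ∀ x → ¬ p ℕ.∣ x * x + 23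
  nonresidue x p∣ = proj₂ legendre (+ x) (subst (p ℕ.∣_) (cong (λ z → ∣ z ℤ.+ + 23 ∣) (ℤ.pos-* x x)) p∣)

  -- Otherwise v has an inverse y modulo p up to sign, and multiplying by y² makes p divide (uy)² +
  -- 23.
  ∣v : ∀ u v → p ℕ.∣ u * u + 23 * (v * v) → p ℕ.∣ v
  ∣v u v p∣ with p ℕ.∣? v
  ... | yes p∣v = p∣v
  ... | no ¬p∣v with coprime-Bézout coprime
    where
    coprime : Coprime p v
    coprime {d} (d∣p , d∣v) with prime⇒irreducible pp d∣p
    ... | inj₁ d≡1  = d≡1
    ... | inj₂ refl = contradiction d∣v ¬p∣v
  -- Here yv ≡ -1. Multiples of 1 + yv are added on both sides so that the identity holds in ℕ
  -- without subtraction.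
  ... | Bézout.+- x y eq = contradiction
    (∣m+n∣n⇒∣m (subst (p ℕ.∣_) (identity u v y) (ℕ.∣m∣n⇒∣m+n (ℕ.∣n⇒∣m*n (y * y) p∣) (ℕ.∣n⇒∣m*n 23 p∣1+yv)))
      (ℕ.∣n⇒∣m*n (23 * (y * v)) p∣1+yv))
    (nonresidue (u * y))
    where
    p∣1+yv : p ℕ.∣ 1 + y * v
    p∣1+yv = ℕ.divides x eq
    identity : ∀ u v y → y * y * (u * u + 23 * (v * v)) + 23 * (1 + y * v) ≡
      u * y * (u * y) + 23 + 23 * (y * v) * (1 + y * v)
    identity = solve-∀
  ... | Bézout.-+ x y eq = contradiction
    (∣m+n∣n⇒∣m (subst (p ℕ.∣_) identity (ℕ.∣n⇒∣m*n (y * y) p∣)) (ℕ.n∣m*n (23 * (x * (2 + x * p)))))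
    (nonresidue (u * y))
    where
    open ≡-Reasoning
    gather : ∀ u v y → y * y * (u * u + 23 * (v * v)) ≡ u * y * (u * y) + 23 * (y * v * (y * v))
    gather = solve-∀
    expand : ∀ w x p → w + 23 * ((1 + x * p) * (1 + x * p)) ≡ w + 23 + 23 * (x * (2 + x * p)) * p
    expand = solve-∀
    identity : y * y * (u * u + 23 * (v * v)) ≡ u * y * (u * y) + 23 + 23 * (x * (2 + x * p)) * p
    identity = trans (gather u v y) (trans (cong (λ t → u * y * (u * y) + 23 * (t * t)) (sym eq))
      (expand (u * y * (u * y)) x p))

  p∤small : ∀ d → suc d ≤ 3 → ¬ p ℕ.∣ suc d
  p∤small d d≤3 p∣d = <⇒≱ 3<p (≤-trans (ℕ.∣⇒≤ p∣d) d≤3)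

  p∤24 : ¬ p ℕ.∣ 24
  p∤24 p∣24 with euclidsLemma 3 8 pp p∣24
  ... | inj₁ p∣3 = p∤small 2 ≤-refl p∣3
  ... | inj₂ p∣8 with euclidsLemma 2 4 pp p∣8
  ... | inj₁ p∣2 = p∤small 1 (s≤s (s≤s z≤n)) p∣2
  ... | inj₂ p∣4 with euclidsLemma 2 2 pp p∣4
  ... | inj₁ p∣2 = p∤small 1 (s≤s (s≤s z≤n)) p∣2
  ... | inj₂ p∣2 = p∤small 1 (s≤s (s≤s z≤n)) p∣2

  -- Both u and v are divisible by p, so p² divides the left side; one p is cancelled against the
  -- right and one remains.
  divide : ∀ u v n → u * u + 23 * (v * v) ≡ p * n → ∃ λ a → ∃ λ b → p * (a * a + 23 * (b * b)) ≡ n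
  divide u v n eq = quotients
    (prime∣square pp u (∣m+n∣n⇒∣m p∣ (ℕ.∣n⇒∣m*n 23 (ℕ.∣n⇒∣m*n v p∣v)))) p∣v
    where
    p∣ : p ℕ.∣ u * u + 23 * (v * v)
    p∣ = subst (p ℕ.∣_) (sym eq) (ℕ.m∣m*n n)
    p∣v : p ℕ.∣ v
    p∣v = ∣v u v p∣
    expand : ∀ a b p → p * (p * (a * a + 23 * (b * b))) ≡ a * p * (a * p) + 23 * (b * p * (b * p))
    expand = solve-∀
    quotients : p ℕ.∣ u → p ℕ.∣ v → ∃ λ a → ∃ λ b → p * (a * a + 23 * (b * b)) ≡ n
    quotients (ℕ.divides a u≡) (ℕ.divides b v≡) = a , b , *-cancelˡ-≡ (p * (a * a + 23 * (b * b))) n p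
      (trans (expand a b p) (trans (cong₂ (λ x y → x * x + 23 * (y * y)) (sym u≡) (sym v≡)) eq))

  -- Each descent removes p², and the odd exponent ends at a single p. There the surplus p from
  -- `divide` would have to divide 24M.
  notRepresented : ∀ M → ¬ p ℕ.∣ M → ∀ α → NotRepresented (24 * (p ^ (2 * α + 1) * M))
  notRepresented M p∤M zero u v eq = absurd (divide u v (24 * M) (trans eq (move p M)))
    where
    move : ∀ p M → 24 * (p * 1 * M) ≡ p * (24 * M)
    move = solve-∀
    absurd : ¬ ∃ λ a → ∃ λ b → p * (a * a + 23 * (b * b)) ≡ 24 * M
    absurd (a , b , eq′) =
      [ p∤24 , p∤M ]′ (euclidsLemma 24 M pp (subst (p ℕ.∣_) eq′ (ℕ.m∣m*n (a * a + 23 * (b * b)))))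
  notRepresented M p∤M (suc α) u v eq = absurd (divide u v (p * (24 * (X * M)))
    (trans eq (trans (cong (λ e → 24 * (p ^ e * M)) (exponent α)) (move p X M))))
    where
    X = p ^ (2 * α + 1)
    exponent : ∀ α → 2 * suc α + 1 ≡ 2 + (2 * α + 1)
    exponent = solve-∀
    move : ∀ p X M → 24 * (p * (p * X) * M) ≡ p * (p * (24 * (X * M)))
    move = solve-∀
    absurd : ¬ ∃ λ a → ∃ λ b → p * (a * a + 23 * (b * b)) ≡ p * (24 * (X * M))
    absurd (a , b , eq′) = notRepresented M p∤M α a b
      (*-cancelˡ-≡ (a * a + 23 * (b * b)) (24 * (X * M)) p eq′)

  part-ii : (n α r : ℕ) → 1 ≤ r → r < p →
    (+ 2) ∣ A 23 (2 * p ^ (2 * α + 1) * (p * n + r) + 2 * p ^ (2 * (α + 1)) + 1)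
  part-ii n α r 1≤r r<p = subst (λ N → (+ 2) ∣ A 23 N)
    (trans (index X p (p * n + r)) (cong (λ e → 2 * X * (p * n + r) + 2 * p ^ e + 1) (exponent α)))
    (A-even (X * M) {{m*n≢0 X M {{m^n≢0 p (2 * α + 1)}} {{>-nonZero M>0}}}} (notRepresented M p∤M α))
    where
    X = p ^ (2 * α + 1)
    -- The summand p comes from 2p^(2α+2) = 2p^(2α+1) · p in the index.
    M = p * n + r + p
    M>0 : 1 ≤ M
    M>0 = ≤-trans 1≤r (≤-trans (m≤n+m r (p * n)) (m≤m+n (p * n + r) p))
    p∤M : ¬ p ℕ.∣ M
    p∤M p∣M = <⇒≱ r<p (ℕ.∣⇒≤ {{>-nonZero 1≤r}}
      (ℕ.∣m+n∣m⇒∣n (∣m+n∣n⇒∣m p∣M ℕ.∣-refl) (ℕ.m∣m*n n)))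
    index : ∀ X p y → 2 * (X * (y + p)) + 1 ≡ 2 * X * y + 2 * (p * X) + 1
    index = solve-∀
    exponent : ∀ α → suc (2 * α + 1) ≡ 2 * (α + 1)
    exponent = solve-∀

theorem1p9 : ((n α r : ℕ) → r ∈ (4 ∷ 6 ∷ 9 ∷ 10 ∷ 13 ∷ 14 ∷ 16 ∷ 18 ∷ 19 ∷ 20 ∷ 21 ∷ []) →
    (+ 2) ∣ A 23 (2 * 23 ^ α * (23 * n + r) + 2 * 23 ^ α + 1))
    ×
    ((p : ℕ) → Prime p → 3 < p → LegendreMinusOne (-[1+ 22 ]) p →
    (n α r : ℕ) → 1 ≤ r → r < p →
    (+ 2) ∣ A 23 (2 * p ^ (2 * α + 1) * (p * n + r) + 2 * p ^ (2 * (α + 1)) + 1))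
theorem1p9 = part-i , λ p → Inert.part-ii
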